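{- For every finite connected weighted graph $G=(V,E,w)$ with $|V|=n\ge2$ and $w:E\to\mathbb{R}_{>0}$, $$1\le\frac{\operatorname{OPT}_{\mathrm{card}}(G,w)}{\operatorname{OPT}_{\mathrm{free}}(G,w)}\le\frac{2n-1}{3}.$$ The upper factor is best possible for every $n\ge2$: equality $\operatorname{OPT}_{\mathrm{card}}/\operatorname{OPT}_{\mathrm{free}}=(2n-1)/3$ holds for the unweighted complete graph $K_n$ (all edge weights equal to $1$).
   Context: $d_G$ is the shortest-path metric of the support graph $(V,E)$ with every edge of length $1$; the weights are not edge lengths. An ultrametric on $V$ is a metric $u$ with $u(x,y)\le\max\{u(x,z),u(z,y)\}$ for all $x,y,z$. $\operatorname{OPT}_{\mathrm{free}}(G,w)$ is the minimum of $\sum_{xy\in E}w_{xy}u(x,y)$ over all ultrametrics $u$ on $V$ with $u(x,y)\ge d_G(x,y)$ for all $x,y\in V$ (the minimum is attained). A rooted binary hierarchy $H$ on $V$ is a rooted tree whose leaves are the vertices of $V$ and whose internal nodes have exactly two children; each node is identified with the set of leaves below it (a cluster), and $C_H(x,y)$ is the cluster of the lowest common ancestor of $x,y$. Put $h_H(x,x)=0$ and $h_H(x,y)=|C_H(x,y)|-1$ for $x\ne y$. $\operatorname{OPT}_{\mathrm{card}}(G,w)$ is the minimum of $\sum_{xy\in E}w_{xy}h_H(x,y)$ over all rooted binary hierarchies $H$ on $V$ with $h_H(x,y)\ge d_G(x,y)$ for all $x,y\in V$. -}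

module Defs where

open import Level using (Level; 0ℓ) renaming (suc to lsuc; _⊔_ to _⊔ˡ_)
open import Algebra.Apartness.Bundles using (HeytingField; HeytingCommutativeRing)
open import Algebra.Bundles using (CommutativeRing)
import Algebra.Definitions.RawMonoid as RawMonoidDefs
import Algebra.Properties.CommutativeMonoid.Sum as Sum
open import Data.Bool.Base using (if_then_else_; _∧_)
open import Data.Fin.Base using (Fin)
import Data.Fin.Base as Fin
import Data.Fin.Properties as Finₚ
open import Data.List.Base using (List; length; allFin)
open import Data.List.Relation.Binary.Permutation.Propositional using (_↭_)
open import Data.Nat.Base using (ℕ; zero; suc; _∸_)
import Data.Nat.Base as ℕ
open import Data.Product.Base using (_×_; _,_; ∃; ∃-syntax; proj₁)
open import Data.Sum.Base using (_⊎_; inj₂)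
open import Data.Tree.Binary using (Tree; leaf; node; module Leaves)
open import Data.Unit.Base using (⊤)
open import Function.Base using (_∘_)
open import Function.Metric.Definitions using (TriangleInequality)
import Function.Metric.Structures as Metric
open import Relation.Binary.Construct.Closure.ReflexiveTransitive using (Star; fold)
open import Relation.Binary.Core using (Rel)
open import Relation.Binary.Definitions using (Decidable; Symmetric; Irreflexive)
open import Relation.Binary.Lattice.Definitions using (Supremum)
open import Relation.Binary.PropositionalEquality.Core using (_≡_; _≢_; ≢-sym)
open import Relation.Binary.Structures using (IsStrictPartialOrder)
open import Relation.Nullary using (Dec; yes; no; does; ¬_; ¬?)

------------------------------------------------------------------------
-- Real numbers

-- The real numbers, characterised up to isomorphism as a Cauchy-complete
-- Archimedean ordered field.  The axioms are phrased constructively, so the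
-- order is not assumed decidable and x ≤ y means that y < x is absurd.
record Reals c ℓ₁ ℓ₂ : Set (lsuc (c ⊔ˡ ℓ₁ ⊔ˡ ℓ₂)) where
  field
    heytingField : HeytingField c ℓ₁ ℓ₂

  open HeytingField heytingField public
  open HeytingCommutativeRing heytingCommutativeRing public using (commutativeRing)

  infix  4 _<_ _≤_
  infixl 6 _⊔_

  field
    _<_                  : Rel Carrier ℓ₂
    isStrictPartialOrder : IsStrictPartialOrder _≈_ _<_
    #⇒<⊎>                : ∀ {x y} → x # y → x < y ⊎ y < x
    <⊎>⇒#                : ∀ {x y} → x < y ⊎ y < x → x # y
    0<1                  : 0# < 1#
    +-monoʳ-<            : ∀ x {y z} → y < z → x + y < x + z
    *-pos                : ∀ {x y} → 0# < x → 0# < y → 0# < x * y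

  open RawMonoidDefs (CommutativeRing.+-rawMonoid commutativeRing) public
    using () renaming (_×_ to _·_)

  field
    _⊔_         : Carrier → Carrier → Carrier
    ⊔-supremum  : Supremum (λ x y → ¬ (y < x)) _⊔_
    archimedean : ∀ x → ∃[ n ] x < n · 1#
    complete    : (s : ℕ → Carrier) →
                  (∀ ε → 0# < ε →
                    ∃[ N ] (∀ i j → N ℕ.≤ i → N ℕ.≤ j → s i - s j < ε)) →
                  ∃[ l ] (∀ ε → 0# < ε →
                    ∃[ N ] (∀ i → N ℕ.≤ i → s i - l < ε × l - s i < ε))

  open Sum (CommutativeRing.+-commutativeMonoid commutativeRing) public using (sum)

  _≤_ : Rel Carrier ℓ₂
  x ≤ y = ¬ (y < x)

  fromℕ : ℕ → Carrier
  fromℕ n = n · 1#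

  0<fromℕ[1+n] : ∀ n → 0# < fromℕ (suc n)
  0<fromℕ[1+n] zero    = <-respʳ-≈ (sym (+-identityʳ 1#)) 0<1
    where open IsStrictPartialOrder isStrictPartialOrder using (<-respʳ-≈)
  0<fromℕ[1+n] (suc n) =
    <-trans 0<1 (<-respˡ-≈ (+-identityʳ 1#) (+-monoʳ-< 1# (0<fromℕ[1+n] n)))
    where
    open IsStrictPartialOrder isStrictPartialOrder
      using (<-respˡ-≈) renaming (trans to <-trans)

  -- #⇒invertible inverts the difference x - 0#, which is equal to x.
  inverse : ∀ {x} → 0# < x → Carrier
  inverse 0<x = proj₁ (#⇒invertible (<⊎>⇒# (inj₂ 0<x)))

  infixl 7 _/_[_]
  _/_[_] : Carrier → (x : Carrier) → 0# < x → Carrier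
  y / x [ 0<x ] = y * inverse 0<x

------------------------------------------------------------------------
-- Rooted binary hierarchies

leaves : ∀ {n} → Tree ⊤ (Fin n) → List (Fin n)
leaves = Leaves.toList

record Hierarchy (n : ℕ) : Set where
  field
    tree          : Tree ⊤ (Fin n)
    leaves↭ : leaves tree ↭ allFin n

-- The subtree rooted at the lowest common ancestor of x and y; only
-- meaningful when both are leaves of the tree.
lca : ∀ {n} → Tree ⊤ (Fin n) → Fin n → Fin n → Tree ⊤ (Fin n)
lca     (leaf v)     x y = leaf v
lca {n} (node l m r) x y =
  if      does (x ∈? leaves l) ∧ does (y ∈? leaves l) then lca l x y
  else if does (x ∈? leaves r) ∧ does (y ∈? leaves r) then lca r x y
  else node l m r
  where open import Data.List.Membership.DecPropositional (Finₚ._≟_ {n}) using (_∈?_)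

-- The length of the list is the size of the cluster because the leaves of a
-- hierarchy are distinct.
cluster : ∀ {n} → Hierarchy n → Fin n → Fin n → List (Fin n)
cluster H x y = leaves (lca (Hierarchy.tree H) x y)

height : ∀ {n} → Hierarchy n → Fin n → Fin n → ℕ
height H x y = if does (x Finₚ.≟ y) then 0 else length (cluster H x y) ∸ 1

------------------------------------------------------------------------
-- Weighted graphs and the two optimisation problems

module Optimisation {c ℓ₁ ℓ₂} (R : Reals c ℓ₁ ℓ₂) where

  open Reals R

  record WeightedGraph (n : ℕ) : Set (lsuc 0ℓ ⊔ˡ c ⊔ˡ ℓ₁ ⊔ˡ ℓ₂) where
    infix 4 _~_ _~?_
    field
      _~_      : Rel (Fin n) 0ℓ
      _~?_     : Decidable _~_
      ~-sym    : Symmetric _~_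
      ~-irrefl : Irreflexive _≡_ _~_
      weight   : ∀ {x y} → x ~ y → Carrier
      -- An edge is an unordered pair: its weight depends neither on its
      -- orientation nor on the proof of adjacency.
      weight-sym : ∀ {x y} (e : x ~ y) (e′ : y ~ x) → weight e ≈ weight e′
      weight-pos : ∀ {x y} (e : x ~ y) → 0# < weight e

  module _ {n : ℕ} (G : WeightedGraph n) where

    open WeightedGraph G

    Connected : Set
    Connected = ∀ x y → Star _~_ x y

    walkLength : ∀ {x y} → Star _~_ x y → ℕ
    walkLength = fold (λ _ _ → ℕ) (λ _ k → suc k) 0

    IsDistance : Fin n → Fin n → ℕ → Set
    IsDistance x y k = (∃[ p ] walkLength {x} {y} p ≡ k) ×
                       (∀ (p : Star _~_ x y) → k ℕ.≤ walkLength p)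

    DominatesDistance : (Fin n → Fin n → Carrier) → Set ℓ₂
    DominatesDistance u = ∀ x y k → IsDistance x y k → fromℕ k ≤ u x y

    -- Each edge {x , y} is counted once, as the pair with x < y.
    cost : (Fin n → Fin n → Carrier) → Carrier
    cost u = sum λ x → sum λ y → term (x Finₚ.<? y) (x ~? y)
      where
      term : ∀ {x y} → Dec (x Fin.< y) → Dec (x ~ y) → Carrier
      term {x} {y} (yes _) (yes e) = weight e * u x y
      term         _       _       = 0#

  record IsUltrametric {n} (u : Fin n → Fin n → Carrier) : Set (c ⊔ˡ ℓ₁ ⊔ˡ ℓ₂) where
    field
      isMetric      : Metric.IsGeneralMetric _≡_ _≈_ _≤_ 0# _+_ u
      ultratriangle : TriangleInequality _≤_ _⊔_ u

  IsMinimum : ∀ {a p} {A : Set a} → (A → Set p) → (A → Carrier) → Carrier →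
              Set (a ⊔ˡ p ⊔ˡ ℓ₁ ⊔ˡ ℓ₂)
  IsMinimum P f m = (∃[ a ] (P a × f a ≈ m)) × (∀ a → P a → m ≤ f a)

  IsOPT-free : ∀ {n} → WeightedGraph n → Carrier → Set (c ⊔ˡ ℓ₁ ⊔ˡ ℓ₂)
  IsOPT-free G = IsMinimum (λ u → IsUltrametric u × DominatesDistance G u) (cost G)

  heightℝ : ∀ {n} → Hierarchy n → Fin n → Fin n → Carrier
  heightℝ H x y = fromℕ (height H x y)

  IsOPT-card : ∀ {n} → WeightedGraph n → Carrier → Set (ℓ₁ ⊔ˡ ℓ₂)
  IsOPT-card G = IsMinimum (DominatesDistance G ∘ heightℝ) (cost G ∘ heightℝ)

  K : ∀ n → WeightedGraph n
  K n = record
    { _~_        = _≢_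
    ; _~?_       = λ x y → ¬? (x Finₚ.≟ y)
    ; ~-sym      = ≢-sym
    ; ~-irrefl   = λ x≡y x≢y → x≢y x≡y
    ; weight     = λ _ → 1#
    ; weight-sym = λ _ _ → refl
    ; weight-pos = λ _ → 0<1
    }

  ⟨2_-1⟩/3 : ℕ → Carrier
  ⟨2 n -1⟩/3 = (fromℕ 2 * fromℕ n - 1#) / fromℕ 3 [ 0<fromℕ[1+n] 2 ]

{-# OPTIONS --safe #-}

-- Let W be the total weight.  A feasible ultrametric is at least 1 on every
-- edge, so OPT-free ≥ W, while heights of feasible hierarchies are feasible
-- ultrametrics, so OPT-free ≤ OPT-card.  For the upper bound it suffices to
-- find a feasible hierarchy of cost at most (2 n - 1) W / 3.  In a connected
-- cluster on m vertices, some vertex v has weighted degree at most 2 W / m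
-- by averaging.  The cluster splits into two connected parts with all cut
-- edges at v, and recursion on the parts gives the bound; each split being
-- crossed by an edge, any two vertices of a cluster are joined by a walk
-- shorter than its size, which is feasibility.  On K n every split into i
-- and j vertices cuts i j edges, and the bound is attained by all hierarchies.
--
-- The minima exist (up to double negation) because only finitely many
-- matrices of bounded natural numbers compete: an ultrametric may be replaced
-- by its integer part, which is again an ultrametric and still dominates the
-- integer-valued distance.
module Submission where

open import Defs
open import Level using (Level; 0ℓ)
open import Algebra.Bundles using (CommutativeRing)
import Algebra.Properties.CommutativeMonoid.Sum as Sum
import Algebra.Properties.CommutativeSemigroup as CommutativeSemigroupProperties
import Algebra.Properties.Ring as RingProperties
import Algebra.Properties.Semiring.Mult as SemiringMult
import Algebra.Solver.Ring.NaturalCoefficients.Default as NaturalCoefficients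
open import Data.Bool.Base using (true; false; if_then_else_; _∧_)
import Data.Bool.Properties as Bool
open import Data.Fin.Base as Fin using (Fin; zero; suc; toℕ; fromℕ<; funToFin; finToFun)
import Data.Fin.Properties as Fin
open import Data.List.Base using (List; []; _∷_; [_]; _++_; length; tabulate; allFin)
import Data.List.Membership.DecPropositional as DecMembership
open import Data.List.Membership.Propositional using (_∈_; _∉_; find; lose)
open import Data.List.Membership.Propositional.Properties using (∈-++⁺ˡ; ∈-++⁺ʳ; ∈-++⁻; ∈-∃++; ∈-allFin)
import Data.List.Properties as List
open import Data.List.Relation.Binary.Disjoint.Propositional using (Disjoint)
open import Data.List.Relation.Binary.Permutation.Propositional as ↭ using (_↭_; ↭⇒↭ₛ)
import Data.List.Relation.Binary.Permutation.Propositional.Properties as ↭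
import Data.List.Relation.Binary.Permutation.Setoid.Properties as ↭ₛ
import Data.List.Relation.Unary.All as All
import Data.List.Relation.Unary.All.Properties as All
open import Data.List.Relation.Unary.AllPairs using ([]; _∷_)
open import Data.List.Relation.Unary.Any using (here; there; any?)
open import Data.List.Relation.Unary.Unique.Propositional using (Unique)
open import Data.List.Relation.Unary.Unique.Propositional.Properties using (allFin⁺)
open import Data.Nat.Base as ℕ using (ℕ; zero; suc; _∸_) renaming (_≤_ to _≤ℕ_)
open import Data.Nat.Induction using (<-rec)
import Data.Nat.Properties as ℕ
open import Data.Product.Base using (_×_; _,_; ∃-syntax; Σ-syntax; proj₁; proj₂)
open import Data.Sum.Base using (_⊎_; inj₁; inj₂; [_,_]′)
open import Data.Tree.Binary using (Tree; leaf; node; module Leaves)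
open import Data.Unit.Base using (⊤; tt)
open import Function.Base using (_∘_; id)
import Function.Metric.Structures as Metric
open import Relation.Binary.Bundles using (Poset)
open import Relation.Binary.Construct.Closure.ReflexiveTransitive as Star using (Star; ε; _◅_; _◅◅_)
open import Relation.Binary.Core using (Rel)
open import Relation.Binary.Definitions using (Decidable; Symmetric; tri<; tri≈; tri>)
open import Relation.Binary.PropositionalEquality as ≡ using (_≡_; _≢_)
import Relation.Binary.Reasoning.PartialOrder
open import Relation.Binary.Structures using (IsPartialOrder; IsStrictPartialOrder)
open import Relation.Nullary using (Dec; yes; no; does)
open import Relation.Nullary.Decidable using (dec-true; dec-false; decidable-stable)
open import Relation.Nullary.Negation.Core using (¬_; contradiction)

private
  variable
    a b p : Level
    A : Set a
    B : Set b
    n : ℕ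

-- Classical reasoning under double negation.

infixl 1 _>>=_
-- With these names a `do` block may branch on undecidable propositions while its goal is doubly
-- negated. A `where` clause attached to a bind treats the remaining branch.
_>>=_ : ¬ ¬ A → (A → ¬ ¬ B) → ¬ ¬ B
(¬¬a >>= f) ¬b = ¬¬a λ a → f a ¬b

return : A → ¬ ¬ A
return a ¬a = ¬a a

excluded-middle : (A : Set a) → ¬ ¬ (A ⊎ ¬ A)
excluded-middle A ¬em = ¬em (inj₂ (¬em ∘ inj₁))

-- Order and field arithmetic of the reals.

module RealsProperties {c ℓ₁ ℓ₂} (R : Reals c ℓ₁ ℓ₂) where

  open Reals R public hiding (zero)
  open CommutativeRing commutativeRing public using (commutativeSemiring; semiring; ring)
  open RingProperties ring using (-0#≈0#; -1*x≈-x)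
  open CommutativeSemigroupProperties (CommutativeRing.+-commutativeSemigroup commutativeRing)
    using () renaming (x∙yz≈y∙xz to +-x∙yz≈y∙xz; interchange to +-interchange)
  open SemiringMult semiring using (×-homo-+; ×1-homo-*)
  open IsStrictPartialOrder isStrictPartialOrder public
    using (<-respʳ-≈; <-respˡ-≈) renaming (trans to <-trans; irrefl to <-irrefl; asym to <-asym)
  open Sum (CommutativeRing.+-commutativeMonoid commutativeRing) public using (sum-cong-≋)
  open NaturalCoefficients commutativeSemiring public using (solve; con; _:=_; _:+_; _:*_; Polynomial)

  -- #2 and #3 evaluate to fromℕ 2 and fromℕ 3, but #1 to 1# rather than fromℕ 1.
  #1 #2 #3 : ∀ {k} → Polynomial k
  #1 = con 1
  #2 = #1 :+ (#1 :+ con 0)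
  #3 = #1 :+ #2

  private
    variable
      x y z w : Carrier

  -- Cotransitivity of apartness decides `x # z` or `z # y`; if the resulting strict inequality
  -- points the wrong way, transitivity with `x < y` gives the other alternative. This takes the
  -- place of trichotomy.
  <-cotrans : x < y → ∀ z → x < z ⊎ z < y
  <-cotrans x<y z with #-cotrans (<⊎>⇒# (inj₁ x<y)) z
  ... | inj₁ x#z with #⇒<⊎> x#z
  ...   | inj₁ x<z = inj₁ x<z
  ...   | inj₂ z<x = inj₂ (<-trans z<x x<y)
  <-cotrans x<y z | inj₂ z#y with #⇒<⊎> z#y
  ...   | inj₁ z<y = inj₂ z<y
  ...   | inj₂ y<z = inj₁ (<-trans x<y y<z)

  <⇒≤ : x < y → x ≤ y
  <⇒≤ = <-asym

  ≤-reflexive : x ≈ y → x ≤ y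
  ≤-reflexive x≈y y<x = <-irrefl (sym x≈y) y<x

  ≤-trans : x ≤ y → y ≤ z → x ≤ z
  ≤-trans {y = y} x≤y y≤z z<x with <-cotrans z<x y
  ... | inj₁ z<y = y≤z z<y
  ... | inj₂ y<x = x≤y y<x

  ≤-antisym : x ≤ y → y ≤ x → x ≈ y
  ≤-antisym {x} {y} x≤y y≤x = proj₁ (tight x y) λ x#y → case (#⇒<⊎> x#y)
    where
    case : ¬ (x < y ⊎ y < x)
    case (inj₁ x<y) = y≤x x<y
    case (inj₂ y<x) = x≤y y<x

  <-≤-trans : x < y → y ≤ z → x < z
  <-≤-trans {z = z} x<y y≤z with <-cotrans x<y z
  ... | inj₁ x<z = x<z
  ... | inj₂ z<y = contradiction z<y y≤z

  -- `≤` is a negation. This is the exit from double negation for inequalities between reals.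
  ≤-stable : ¬ ¬ (x ≤ y) → x ≤ y
  ≤-stable ¬¬x≤y y<x = ¬¬x≤y λ x≤y → x≤y y<x

  -- A refutation of `x < y` is `y ≤ x` by definition, so antisymmetry applies. Weak monotonicity
  -- laws thereby reduce to strict ones and congruence.
  ≤⇒¬¬<⊎≈ : x ≤ y → ¬ ¬ (x < y ⊎ x ≈ y)
  ≤⇒¬¬<⊎≈ x≤y ¬< = ¬< (inj₂ (≤-antisym x≤y (¬< ∘ inj₁)))

  ≤-total : ∀ x y → ¬ ¬ (x ≤ y ⊎ y ≤ x)
  ≤-total x y ¬tot = ¬tot (inj₁ λ y<x → ¬tot (inj₂ (<⇒≤ y<x)))

  ≤-isPartialOrder : IsPartialOrder _≈_ _≤_
  ≤-isPartialOrder = record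
    { isPreorder = record
      { isEquivalence = isEquivalence
      ; reflexive     = ≤-reflexive
      ; trans         = ≤-trans
      }
    ; antisym = ≤-antisym
    }

  ≤-poset : Poset c ℓ₁ ℓ₂
  ≤-poset = record { isPartialOrder = ≤-isPartialOrder }

  module ≤-Reasoning = Relation.Binary.Reasoning.PartialOrder ≤-poset

  ≤-refl : x ≤ x
  ≤-refl = ≤-reflexive refl

  +-monoʳ-≤ : ∀ x → y ≤ z → x + y ≤ x + z
  +-monoʳ-≤ x y≤z = ≤-stable do
    inj₁ y<z ← ≤⇒¬¬<⊎≈ y≤z
      where inj₂ y≈z → return (≤-reflexive (+-congˡ y≈z))
    return (<⇒≤ (+-monoʳ-< x y<z))

  +-mono-≤ : x ≤ y → z ≤ w → x + z ≤ y + w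
  +-mono-≤ {x} {y} {z} {w} x≤y z≤w = begin
    x + z ≈⟨ +-comm x z ⟩
    z + x ≤⟨ +-monoʳ-≤ z x≤y ⟩
    z + y ≈⟨ +-comm z y ⟩
    y + z ≤⟨ +-monoʳ-≤ y z≤w ⟩
    y + w ∎
    where open ≤-Reasoning

  x≤x+y : ∀ x → 0# ≤ y → x ≤ x + y
  x≤x+y {y} x 0≤y = begin
    x      ≈⟨ +-identityʳ x ⟨
    x + 0# ≤⟨ +-monoʳ-≤ x 0≤y ⟩
    x + y  ∎
    where open ≤-Reasoning

  x≤y+x : ∀ x → 0# ≤ y → x ≤ y + x
  x≤y+x x 0≤y = ≤-trans (x≤x+y x 0≤y) (≤-reflexive (+-comm _ _))

  -- The axioms only speak of products of positives, so `*-pos` is applied to `x` and `- y + z`, and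
  -- `x * y` is added to both sides.
  *-monoʳ-< : 0# < x → y < z → x * y < x * z
  *-monoʳ-< {x} {y} {z} 0<x y<z =
    <-respˡ-≈ (+-identityʳ (x * y))
      (<-respʳ-≈ cancel (+-monoʳ-< (x * y) (*-pos 0<x 0<z-y)))
    where
    0<z-y : 0# < - y + z
    0<z-y = <-respˡ-≈ (-‿inverseˡ y) (+-monoʳ-< (- y) y<z)
    cancel : x * y + x * (- y + z) ≈ x * z
    cancel = trans (sym (distribˡ x y (- y + z)))
      (*-congˡ (trans (sym (+-assoc y (- y) z))
        (trans (+-congʳ (-‿inverseʳ y)) (+-identityˡ z))))

  *-monoʳ-≤ : 0# ≤ x → y ≤ z → x * y ≤ x * z
  *-monoʳ-≤ {x} {y} {z} 0≤x y≤z = ≤-stable do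
    inj₁ 0<x ← ≤⇒¬¬<⊎≈ 0≤x
      where
      inj₂ 0≈x → return (≤-reflexive (trans (*-congʳ (sym 0≈x))
        (trans (zeroˡ y) (trans (sym (zeroˡ z)) (*-congʳ 0≈x)))))
    inj₁ y<z ← ≤⇒¬¬<⊎≈ y≤z
      where inj₂ y≈z → return (≤-reflexive (*-congˡ y≈z))
    return (<⇒≤ (*-monoʳ-< 0<x y<z))

  *-monoˡ-≤ : 0# ≤ x → y ≤ z → y * x ≤ z * x
  *-monoˡ-≤ {x} {y} {z} 0≤x y≤z = begin
    y * x ≈⟨ *-comm y x ⟩
    x * y ≤⟨ *-monoʳ-≤ 0≤x y≤z ⟩
    x * z ≈⟨ *-comm x z ⟩
    z * x ∎
    where open ≤-Reasoning

  *-nonNeg : 0# ≤ x → 0# ≤ y → 0# ≤ x * y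
  *-nonNeg {x} 0≤x 0≤y = ≤-trans (≤-reflexive (sym (zeroʳ x))) (*-monoʳ-≤ 0≤x 0≤y)

  x≤x⊔y : ∀ x y → x ≤ x ⊔ y
  x≤x⊔y x y = proj₁ (⊔-supremum x y)

  y≤x⊔y : ∀ x y → y ≤ x ⊔ y
  y≤x⊔y x y = proj₁ (proj₂ (⊔-supremum x y))

  ⊔-lub : x ≤ z → y ≤ z → x ⊔ y ≤ z
  ⊔-lub = proj₂ (proj₂ (⊔-supremum _ _)) _

  -- A supremum need not equal one of its arguments constructively; a classical comparison of `x`
  -- and `y` bounds it by the larger one.
  ≤⊔⇒¬¬≤⊎≤ : z ≤ x ⊔ y → ¬ ¬ (z ≤ x ⊎ z ≤ y)
  ≤⊔⇒¬¬≤⊎≤ {z} {x} {y} z≤x⊔y = do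
    inj₁ x≤y ← ≤-total x y
      where inj₂ y≤x → return (inj₁ (≤-trans z≤x⊔y (⊔-lub ≤-refl y≤x)))
    return (inj₂ (≤-trans z≤x⊔y (⊔-lub x≤y ≤-refl)))

  fromℕ-+ : ∀ m n → fromℕ (m ℕ.+ n) ≈ fromℕ m + fromℕ n
  fromℕ-+ = ×-homo-+ 1#

  fromℕ-* : ∀ m n → fromℕ (m ℕ.* n) ≈ fromℕ m * fromℕ n
  fromℕ-* = ×1-homo-*

  fromℕ-nonNeg : ∀ n → 0# ≤ fromℕ n
  fromℕ-nonNeg zero    = ≤-refl
  fromℕ-nonNeg (suc n) = <⇒≤ (0<fromℕ[1+n] n)

  fromℕ-mono : ∀ {m n} → m ℕ.≤ n → fromℕ m ≤ fromℕ n
  fromℕ-mono {n = n} ℕ.z≤n = fromℕ-nonNeg n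
  fromℕ-mono (ℕ.s≤s m≤n)   = +-monoʳ-≤ 1# (fromℕ-mono m≤n)

  fromℕ≈0⇒≡0 : ∀ n → fromℕ n ≈ 0# → n ≡ 0
  fromℕ≈0⇒≡0 zero    _  = ≡.refl
  fromℕ≈0⇒≡0 (suc n) eq = contradiction (0<fromℕ[1+n] n) (<-irrefl (sym eq))

  inverse-*ʳ : (0<x : 0# < x) → x * inverse 0<x ≈ 1#
  inverse-*ʳ {x} 0<x = trans (*-congʳ (sym (trans (+-congˡ -0#≈0#) (+-identityʳ x))))
    (proj₂ (proj₂ (#⇒invertible (<⊎>⇒# (inj₂ 0<x)))))

  -- A negative inverse, multiplied by `x`, would give `1# < 0#`.
  inverse-nonNeg : (0<x : 0# < x) → 0# ≤ inverse 0<x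
  inverse-nonNeg {x} 0<x inv<0 = <-asym 0<1
    (<-respˡ-≈ (inverse-*ʳ 0<x) (<-respʳ-≈ (zeroʳ x) (*-monoʳ-< 0<x inv<0)))

  x≤y⇒1≤y/x : (0<x : 0# < x) → x ≤ y → 1# ≤ y / x [ 0<x ]
  x≤y⇒1≤y/x {x} {y} 0<x x≤y = begin
    1#              ≈⟨ inverse-*ʳ 0<x ⟨
    x * inverse 0<x ≤⟨ *-monoˡ-≤ (inverse-nonNeg 0<x) x≤y ⟩
    y * inverse 0<x ∎
    where open ≤-Reasoning

  *-cancelˡ : 0# < z → z * x ≈ z * y → x ≈ y
  *-cancelˡ {z} {x} {y} 0<z zx≈zy = begin
    x                   ≈⟨ absorb x ⟨
    inverse 0<z * (z * x) ≈⟨ *-congˡ zx≈zy ⟩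
    inverse 0<z * (z * y) ≈⟨ absorb y ⟩
    y                   ∎
    where
    open import Relation.Binary.Reasoning.Setoid setoid
    absorb : ∀ x → inverse 0<z * (z * x) ≈ x
    absorb x = trans (sym (*-assoc _ z x))
      (trans (*-congʳ (trans (*-comm _ z) (inverse-*ʳ 0<z))) (*-identityˡ x))

  private
    [x+w]-w : ∀ x w → x + w - w ≈ x
    [x+w]-w x w = trans (+-assoc x w (- w)) (trans (+-congˡ (-‿inverseʳ w)) (+-identityʳ x))

    yw-w : ∀ y w → y * w - w ≈ (y - 1#) * w
    yw-w y w = sym (trans (distribʳ w y (- 1#)) (+-congˡ (-1*x≈-x w)))

  -- The inductions on trees use the form with `x + w`, which is free of subtraction and so within
  -- reach of the semiring solver. The factor `2 n - 1` appears only through this conversion.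
  x+w≤yw⇒x≤[y-1]w : x + w ≤ y * w → x ≤ (y - 1#) * w
  x+w≤yw⇒x≤[y-1]w {x} {w} {y} x+w≤yw = begin
    x            ≈⟨ [x+w]-w x w ⟨
    x + w - w    ≤⟨ +-mono-≤ x+w≤yw ≤-refl ⟩
    y * w - w    ≈⟨ yw-w y w ⟩
    (y - 1#) * w ∎
    where open ≤-Reasoning

  x+w≈yw⇒x≈[y-1]w : x + w ≈ y * w → x ≈ (y - 1#) * w
  x+w≈yw⇒x≈[y-1]w {x} {w} {y} x+w≈yw =
    trans (sym ([x+w]-w x w)) (trans (+-congʳ x+w≈yw) (yw-w y w))

  private
    *-cross : ∀ x u i j → x * u * (i * j) ≈ (x * i) * (u * j)
    *-cross = solve 4 (λ x u i j → x :* u :* (i :* j) := (x :* i) :* (u :* j)) refl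

    /-numerator : (0<x : 0# < x) (0<z : 0# < z) → z * y * (inverse 0<x * inverse 0<z) ≈ y / x [ 0<x ]
    /-numerator {x} {z} {y} 0<x 0<z = begin
      z * y * (i * j)   ≈⟨ *-congˡ (*-comm i j) ⟩
      z * y * (j * i)   ≈⟨ *-cross z y j i ⟩
      (z * j) * (y * i) ≈⟨ *-congʳ (inverse-*ʳ 0<z) ⟩
      1# * (y * i)      ≈⟨ *-identityˡ (y * i) ⟩
      y * i             ∎
      where
      open import Relation.Binary.Reasoning.Setoid setoid
      i = inverse 0<x
      j = inverse 0<z

    /-denominator : (0<x : 0# < x) (0<z : 0# < z) → w * x * (inverse 0<x * inverse 0<z) ≈ w / z [ 0<z ]
    /-denominator {x} {z} {w} 0<x 0<z = trans (*-congʳ (*-comm w x)) (trans (*-congˡ (*-comm _ _)) (/-numerator 0<z 0<x))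

  -- Multiplying the hypothesis by both inverses, whose product is nonnegative, cancels `z` on the
  -- left and `x` on the right.
  /-cross-≤ : (0<x : 0# < x) (0<z : 0# < z) → z * y ≤ w * x → y / x [ 0<x ] ≤ w / z [ 0<z ]
  /-cross-≤ {x} {z} {y} {w} 0<x 0<z zy≤wx = begin
    y / x [ 0<x ]                             ≈⟨ /-numerator 0<x 0<z ⟨
    z * y * (inverse 0<x * inverse 0<z)       ≤⟨ *-monoˡ-≤ (*-nonNeg (inverse-nonNeg 0<x) (inverse-nonNeg 0<z)) zy≤wx ⟩
    w * x * (inverse 0<x * inverse 0<z)       ≈⟨ /-denominator 0<x 0<z ⟩
    w / z [ 0<z ]                             ∎
    where open ≤-Reasoning

  /-cross-≈ : (0<x : 0# < x) (0<z : 0# < z) → z * y ≈ w * x → y / x [ 0<x ] ≈ w / z [ 0<z ]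
  /-cross-≈ 0<x 0<z zy≈wx =
    trans (sym (/-numerator 0<x 0<z)) (trans (*-congʳ zy≈wx) (/-denominator 0<x 0<z))

  -- Sums and minima over finite lists.

  infixr 6.5 ∑
  -- Indexing by lists lets a sum range over a single cluster, split along `_++_` and be rearranged
  -- along `_↭_`.
  ∑ : List A → (A → Carrier) → Carrier
  ∑ []       f = 0#
  ∑ (x ∷ xs) f = f x + ∑ xs f
  syntax ∑ xs (λ x → e) = ∑[ x ∈ xs ] e

  ∑-mono : ∀ {f g : A → Carrier} xs → (∀ {x} → x ∈ xs → f x ≤ g x) → ∑ xs f ≤ ∑ xs g
  ∑-mono []       f≤g = ≤-refl
  ∑-mono (x ∷ xs) f≤g = +-mono-≤ (f≤g (here ≡.refl)) (∑-mono xs (f≤g ∘ there))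

  ∑-cong : ∀ {f g : A → Carrier} xs → (∀ {x} → x ∈ xs → f x ≈ g x) → ∑ xs f ≈ ∑ xs g
  ∑-cong []       f≈g = refl
  ∑-cong (x ∷ xs) f≈g = +-cong (f≈g (here ≡.refl)) (∑-cong xs (f≈g ∘ there))

  ∑-zero : ∀ {f : A → Carrier} xs → (∀ {x} → x ∈ xs → f x ≈ 0#) → ∑ xs f ≈ 0#
  ∑-zero []       f≈0 = refl
  ∑-zero (x ∷ xs) f≈0 = trans (+-cong (f≈0 (here ≡.refl)) (∑-zero xs (f≈0 ∘ there))) (+-identityˡ 0#)

  ∑-nonNeg : ∀ {f : A → Carrier} xs → (∀ x → 0# ≤ f x) → 0# ≤ ∑ xs f
  ∑-nonNeg []       0≤f = ≤-refl
  ∑-nonNeg (x ∷ xs) 0≤f = ≤-trans (0≤f x) (x≤x+y _ (∑-nonNeg xs 0≤f))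

  term≤∑ : ∀ {f : A → Carrier} {x xs} → x ∈ xs → (∀ x → 0# ≤ f x) → f x ≤ ∑ xs f
  term≤∑ {xs = _ ∷ xs} (here ≡.refl) 0≤f = x≤x+y _ (∑-nonNeg xs 0≤f)
  term≤∑ {f = f} {xs = y ∷ _} (there x∈xs) 0≤f = ≤-trans (term≤∑ x∈xs 0≤f) (x≤y+x _ (0≤f y))

  ∑-++ : ∀ {f : A → Carrier} xs {ys} → ∑ (xs ++ ys) f ≈ ∑ xs f + ∑ ys f
  ∑-++ []       = sym (+-identityˡ _)
  ∑-++ (x ∷ xs) = trans (+-congˡ (∑-++ xs)) (sym (+-assoc _ _ _))

  ∑-↭ : ∀ {f : A → Carrier} {xs ys} → xs ↭ ys → ∑ xs f ≈ ∑ ys f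
  ∑-↭ ↭.refl          = refl
  ∑-↭ (↭.prep x p)    = +-congˡ (∑-↭ p)
  ∑-↭ (↭.swap x y p)  = trans (+-congˡ (+-congˡ (∑-↭ p))) (+-x∙yz≈y∙xz _ _ _)
  ∑-↭ (↭.trans p q)   = trans (∑-↭ p) (∑-↭ q)

  ∑-+ : ∀ {f g : A → Carrier} xs → ∑[ x ∈ xs ] (f x + g x) ≈ ∑ xs f + ∑ xs g
  ∑-+ []       = sym (+-identityˡ 0#)
  ∑-+ (x ∷ xs) = trans (+-congˡ (∑-+ xs)) (+-interchange _ _ _ _)

  ∑-*ˡ : ∀ {f : A → Carrier} a xs → ∑[ x ∈ xs ] (a * f x) ≈ a * ∑ xs f
  ∑-*ˡ a []       = sym (zeroʳ a)
  ∑-*ˡ a (x ∷ xs) = trans (+-congˡ (∑-*ˡ a xs)) (sym (distribˡ a _ _))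

  ∑-const : ∀ a (xs : List A) → ∑[ _ ∈ xs ] a ≈ fromℕ (length xs) * a
  ∑-const a []       = sym (zeroˡ a)
  ∑-const a (x ∷ xs) = begin
    a + ∑[ _ ∈ xs ] a                ≈⟨ +-cong (sym (*-identityˡ a)) (∑-const a xs) ⟩
    1# * a + fromℕ (length xs) * a   ≈⟨ distribʳ a 1# (fromℕ (length xs)) ⟨
    fromℕ (suc (length xs)) * a      ∎
    where open import Relation.Binary.Reasoning.Setoid setoid

  ∑-swap : ∀ {f : A → B → Carrier} xs ys →
           ∑[ x ∈ xs ] ∑[ y ∈ ys ] f x y ≈ ∑[ y ∈ ys ] ∑[ x ∈ xs ] f x y
  ∑-swap []       ys = sym (∑-zero ys λ _ → refl)
  ∑-swap (x ∷ xs) ys = trans (+-congˡ (∑-swap xs ys)) (sym (∑-+ ys))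

  -- The function `g` is arbitrary because the tail of `tabulate g` is `tabulate (g ∘ suc)`.
  sum≡∑ : ∀ {m n} (f : Fin m → Carrier) (g : Fin n → Fin m) → sum (f ∘ g) ≡ ∑ (tabulate g) f
  sum≡∑ {n = zero}  f g = ≡.refl
  sum≡∑ {n = suc n} f g = ≡.cong (f (g zero) +_) (sum≡∑ f (g ∘ suc))

  -- Neither `P` nor the order is decidable, so each list element costs one classical decision of
  -- `P` and possibly one classical comparison with the minimum of the tail.
  minimum : (xs : List A) (P : A → Set p) (f : A → Carrier) →
            ¬ ¬ ((∀ {x} → x ∈ xs → ¬ P x) ⊎
                 ∃[ x ] (x ∈ xs × P x × (∀ {y} → y ∈ xs → P y → f x ≤ f y)))
  minimum []       P f = return (inj₁ λ ())
  minimum (x ∷ xs) P f = do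
    Px ← excluded-middle (P x)
    IH ← minimum xs P f
    cons Px IH
    where
    Goal = (∀ {y} → y ∈ x ∷ xs → ¬ P y) ⊎
           ∃[ z ] (z ∈ x ∷ xs × P z × (∀ {y} → y ∈ x ∷ xs → P y → f z ≤ f y))
    cons : P x ⊎ ¬ P x → _ → ¬ ¬ Goal
    cons (inj₁ Px) (inj₁ none) = return (inj₂ (x , here ≡.refl , Px , λ where
      (here ≡.refl) _  → ≤-refl
      (there y∈xs)  Py → contradiction Py (none y∈xs)))
    cons (inj₂ ¬Px) (inj₁ none) = return (inj₁ λ where
      (here ≡.refl) → ¬Px
      (there y∈xs)  → none y∈xs)
    cons (inj₂ ¬Px) (inj₂ (z , z∈xs , Pz , z-min)) = return (inj₂ (z , there z∈xs , Pz , λ where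
      (here ≡.refl) Px → contradiction Px ¬Px
      (there y∈xs)  Py → z-min y∈xs Py))
    cons (inj₁ Px) (inj₂ (z , z∈xs , Pz , z-min)) = do
      inj₁ fx≤fz ← ≤-total (f x) (f z)
        where
        inj₂ fz≤fx → return (inj₂ (z , there z∈xs , Pz , λ where
          (here ≡.refl) _  → fz≤fx
          (there y∈xs)  Py → z-min y∈xs Py))
      return (inj₂ (x , here ≡.refl , Px , λ where
        (here ≡.refl) _  → ≤-refl
        (there y∈xs)  Py → ≤-trans fx≤fz (z-min y∈xs Py)))

  -- A minimiser of `f` on the list works: replacing every term by the least one does not increase
  -- the sum.
  averaging : ∀ {x : A} xs → x ∈ xs → (f : A → Carrier) →
              ¬ ¬ (∃[ y ] (y ∈ xs × fromℕ (length xs) * f y ≤ ∑ xs f))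
  averaging {x = x} xs x∈xs f = do
    inj₂ (y , y∈xs , _ , y-min) ← minimum xs (λ _ → ⊤) f
      where inj₁ none → contradiction tt (none x∈xs)
    return (y , y∈xs , ≤-trans (≤-reflexive (sym (∑-const (f y) xs))) (∑-mono xs λ z∈xs → y-min z∈xs tt))

-- Repetition-free lists, binary trees and lowest common ancestors.

Unique-++⁻ : ∀ (xs : List A) {ys} → Unique (xs ++ ys) → Unique xs × Unique ys × Disjoint xs ys
Unique-++⁻ []       u          = [] , u , λ ()
Unique-++⁻ (x ∷ xs) (x∉ ∷ u) with uxs , uys , disj ← Unique-++⁻ xs u =
  All.++⁻ˡ xs x∉ ∷ uxs , uys , λ where
    (here ≡.refl , x∈ys) → All.lookup (All.++⁻ʳ xs x∉) x∈ys ≡.refl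
    (there z∈xs  , z∈ys) → disj (z∈xs , z∈ys)

Unique-resp-↭ : ∀ {xs ys : List A} → xs ↭ ys → Unique xs → Unique ys
Unique-resp-↭ xs↭ys = ↭ₛ.Unique-resp-↭ (≡.setoid _) (↭⇒↭ₛ xs↭ys)

-- `Leaves.toList` is computed through difference lists, so the induction carries an arbitrary tail
-- `xs`.
leaves-node : (l : Tree ⊤ (Fin n)) {m : ⊤} (r : Tree ⊤ (Fin n)) → leaves (node l m r) ≡ leaves l ++ leaves r
leaves-node l r = toDiffList-++ l (leaves r)
  where
  toDiffList-++ : ∀ (t : Tree ⊤ (Fin n)) xs → Leaves.toDiffList t xs ≡ leaves t ++ xs
  toDiffList-++ (leaf x)     xs = ≡.refl
  toDiffList-++ (node l m r) xs = begin
    Leaves.toDiffList l (Leaves.toDiffList r xs) ≡⟨ toDiffList-++ l _ ⟩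
    leaves l ++ Leaves.toDiffList r xs           ≡⟨ ≡.cong (leaves l ++_) (toDiffList-++ r xs) ⟩
    leaves l ++ (leaves r ++ xs)                 ≡⟨ List.++-assoc (leaves l) (leaves r) xs ⟨
    (leaves l ++ leaves r) ++ xs                 ≡⟨ ≡.cong (_++ xs) (toDiffList-++ l (leaves r)) ⟨
    leaves (node l m r) ++ xs                    ∎
    where open ≡.≡-Reasoning

∣_∣ : Tree ⊤ (Fin n) → ℕ
∣ t ∣ = length (leaves t)

∣node∣ : (l : Tree ⊤ (Fin n)) {m : ⊤} (r : Tree ⊤ (Fin n)) → ∣ node l m r ∣ ≡ ∣ l ∣ ℕ.+ ∣ r ∣
∣node∣ l r = ≡.trans (≡.cong length (leaves-node l r)) (List.length-++ (leaves l))

∣t∣≥1 : (t : Tree ⊤ (Fin n)) → 1 ℕ.≤ ∣ t ∣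
∣t∣≥1 (leaf x)     = ℕ.≤-refl
∣t∣≥1 (node l m r) rewrite ∣node∣ l {m} r = ℕ.≤-trans (∣t∣≥1 l) (ℕ.m≤m+n ∣ l ∣ ∣ r ∣)

module _ {n : ℕ} where

  open DecMembership (Fin._≟_ {n}) using (_∈?_)

  private
    variable
      x y z : Fin n

  Unique-node⁻ : ∀ (l : Tree ⊤ (Fin n)) {m} (r : Tree ⊤ (Fin n)) → Unique (leaves (node l m r)) →
                 Unique (leaves l) × Unique (leaves r) × Disjoint (leaves l) (leaves r)
  Unique-node⁻ l {m} r u rewrite leaves-node l {m} r = Unique-++⁻ (leaves l) u

  ∈-node⁻ : ∀ (l : Tree ⊤ (Fin n)) {m} (r : Tree ⊤ (Fin n)) → x ∈ leaves (node l m r) → x ∈ leaves l ⊎ x ∈ leaves r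
  ∈-node⁻ l {m} r x∈ rewrite leaves-node l {m} r = ∈-++⁻ (leaves l) x∈

  module _ (l : Tree ⊤ (Fin n)) {m : ⊤} (r : Tree ⊤ (Fin n)) (disj : Disjoint (leaves l) (leaves r)) where

    lca-left : x ∈ leaves l → y ∈ leaves l → lca (node l m r) x y ≡ lca l x y
    lca-left {x} {y} x∈l y∈l
      rewrite dec-true (x ∈? leaves l) x∈l | dec-true (y ∈? leaves l) y∈l = ≡.refl

    lca-right : x ∈ leaves r → y ∈ leaves r → lca (node l m r) x y ≡ lca r x y
    lca-right {x} {y} x∈r y∈r
      rewrite dec-false (x ∈? leaves l) (λ x∈l → disj (x∈l , x∈r))
            | dec-true (x ∈? leaves r) x∈r | dec-true (y ∈? leaves r) y∈r = ≡.refl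

    lca-acrossˡ : x ∈ leaves l → y ∈ leaves r → lca (node l m r) x y ≡ node l m r
    lca-acrossˡ {x} {y} x∈l y∈r
      rewrite dec-true (x ∈? leaves l) x∈l
            | dec-false (y ∈? leaves l) (λ y∈l → disj (y∈l , y∈r))
            | dec-false (x ∈? leaves r) (λ x∈r → disj (x∈l , x∈r)) = ≡.refl

    lca-acrossʳ : x ∈ leaves r → y ∈ leaves l → lca (node l m r) x y ≡ node l m r
    lca-acrossʳ {x} {y} x∈r y∈l
      rewrite dec-false (x ∈? leaves l) (λ x∈l → disj (x∈l , x∈r))
            | dec-true (x ∈? leaves r) x∈r
            | dec-false (y ∈? leaves r) (λ y∈r → disj (y∈l , y∈r)) = ≡.refl

  lca-sym : ∀ t x y → lca t x y ≡ lca t y x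
  lca-sym (leaf _)     x y = ≡.refl
  lca-sym (node l m r) x y
    rewrite Bool.∧-comm (does (x ∈? leaves l)) (does (y ∈? leaves l))
          | Bool.∧-comm (does (x ∈? leaves r)) (does (y ∈? leaves r))
          | lca-sym l x y | lca-sym r x y = ≡.refl

  ∣lca∣≤∣t∣ : ∀ t x y → ∣ lca t x y ∣ ℕ.≤ ∣ t ∣
  ∣lca∣≤∣t∣ (leaf _)     x y = ℕ.≤-refl
  ∣lca∣≤∣t∣ (node l m r) x y
    with does (x ∈? leaves l) ∧ does (y ∈? leaves l) | does (x ∈? leaves r) ∧ does (y ∈? leaves r)
  ... | true  | _ = ℕ.≤-trans (∣lca∣≤∣t∣ l x y)
    (ℕ.≤-trans (ℕ.m≤m+n ∣ l ∣ ∣ r ∣) (ℕ.≤-reflexive (≡.sym (∣node∣ l r))))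
  ... | false | true = ℕ.≤-trans (∣lca∣≤∣t∣ r x y)
    (ℕ.≤-trans (ℕ.m≤n+m ∣ r ∣ ∣ l ∣) (ℕ.≤-reflexive (≡.sym (∣node∣ l r))))
  ... | false | false = ℕ.≤-refl

  -- The lowest common ancestor is reached by descending through children, so hereditary properties
  -- pass to it; `Linked` will be such a property.
  lca-preserves : ∀ {p} (P : Tree ⊤ (Fin n) → Set p) →
                  (∀ {l m r} → P (node l m r) → P l × P r) → ∀ t x y → P t → P (lca t x y)
  lca-preserves P P-node⁻ (leaf _)     x y Pt = Pt
  lca-preserves P P-node⁻ (node l m r) x y Pt
    with does (x ∈? leaves l) ∧ does (y ∈? leaves l) | does (x ∈? leaves r) ∧ does (y ∈? leaves r)
  ... | true  | _          = lca-preserves P P-node⁻ l x y (proj₁ (P-node⁻ Pt))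
  ... | false | true  = lca-preserves P P-node⁻ r x y (proj₂ (P-node⁻ Pt))
  ... | false | false = Pt

  ∈-lca : ∀ t → Unique (leaves t) → x ∈ leaves t → y ∈ leaves t →
          x ∈ leaves (lca t x y) × y ∈ leaves (lca t x y)
  ∈-lca (leaf _)     u x∈ y∈ = x∈ , y∈
  ∈-lca {x} {y} (node l m r) u x∈ y∈
    with ul , ur , disj ← Unique-node⁻ l {m} r u
    with ∈-node⁻ l {m} r x∈ | ∈-node⁻ l {m} r y∈
  ... | inj₁ x∈l | inj₁ y∈l rewrite lca-left l {m} r disj x∈l y∈l = ∈-lca l ul x∈l y∈l
  ... | inj₂ x∈r | inj₂ y∈r rewrite lca-right l {m} r disj x∈r y∈r = ∈-lca r ur x∈r y∈r
  ... | inj₁ x∈l | inj₂ y∈r rewrite lca-acrossˡ l {m} r disj x∈l y∈r = x∈ , y∈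
  ... | inj₂ x∈r | inj₁ y∈l rewrite lca-acrossʳ l {m} r disj x∈r y∈l = x∈ , y∈

  -- If all three leaves lie in one child, recurse. Otherwise the root separates `x` from `y` or `y`
  -- from `z`, and the cluster of that pair is the whole tree.
  ∣lca∣-ultra : ∀ t → Unique (leaves t) → x ∈ leaves t → y ∈ leaves t → z ∈ leaves t →
                ∣ lca t x z ∣ ℕ.≤ ∣ lca t x y ∣ ℕ.⊔ ∣ lca t y z ∣
  ∣lca∣-ultra (leaf _) u x∈ y∈ z∈ = ℕ.≤-refl
  ∣lca∣-ultra {x} {y} {z} (node l m r) u x∈ y∈ z∈
    with ul , ur , disj ← Unique-node⁻ l {m} r u
    with ∈-node⁻ l {m} r x∈ | ∈-node⁻ l {m} r y∈ | ∈-node⁻ l {m} r z∈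
  ... | inj₁ x∈l | inj₁ y∈l | inj₁ z∈l
    rewrite lca-left l {m} r disj x∈l y∈l | lca-left l {m} r disj y∈l z∈l | lca-left l {m} r disj x∈l z∈l =
    ∣lca∣-ultra l ul x∈l y∈l z∈l
  ... | inj₂ x∈r | inj₂ y∈r | inj₂ z∈r
    rewrite lca-right l {m} r disj x∈r y∈r | lca-right l {m} r disj y∈r z∈r | lca-right l {m} r disj x∈r z∈r =
    ∣lca∣-ultra r ur x∈r y∈r z∈r
  ... | inj₁ x∈l | inj₂ y∈r | _ rewrite lca-acrossˡ l {m} r disj x∈l y∈r =
    ℕ.≤-trans (∣lca∣≤∣t∣ (node l m r) x z) (ℕ.m≤m⊔n _ _)
  ... | inj₂ x∈r | inj₁ y∈l | _ rewrite lca-acrossʳ l {m} r disj x∈r y∈l =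
    ℕ.≤-trans (∣lca∣≤∣t∣ (node l m r) x z) (ℕ.m≤m⊔n _ _)
  ... | inj₁ _   | inj₁ y∈l | inj₂ z∈r rewrite lca-acrossˡ l {m} r disj y∈l z∈r =
    ℕ.≤-trans (∣lca∣≤∣t∣ (node l m r) x z) (ℕ.m≤n⊔m ∣ lca (node l m r) x y ∣ _)
  ... | inj₂ _   | inj₂ y∈r | inj₁ z∈l rewrite lca-acrossʳ l {m} r disj y∈r z∈l =
    ℕ.≤-trans (∣lca∣≤∣t∣ (node l m r) x z) (ℕ.m≤n⊔m ∣ lca (node l m r) x y ∣ _)

  -- Agrees definitionally with `height` on the tree of a hierarchy, but also applies to subtrees,
  -- as inductions require.
  heightᵗ : Tree ⊤ (Fin n) → Fin n → Fin n → ℕ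
  heightᵗ t x y = if does (x Fin.≟ y) then 0 else ∣ lca t x y ∣ ∸ 1

  heightᵗ-refl : ∀ t x → heightᵗ t x x ≡ 0
  heightᵗ-refl t x rewrite dec-true (x Fin.≟ x) ≡.refl = ≡.refl

  heightᵗ-≢ : ∀ t → x ≢ y → heightᵗ t x y ≡ ∣ lca t x y ∣ ∸ 1
  heightᵗ-≢ {x} {y} t x≢y rewrite dec-false (x Fin.≟ y) x≢y = ≡.refl

distinct-∈⇒2≤length : ∀ {x y : A} {xs} → x ∈ xs → y ∈ xs → x ≢ y → 2 ℕ.≤ length xs
distinct-∈⇒2≤length (here ≡.refl) (here ≡.refl) x≢y = contradiction ≡.refl x≢y
distinct-∈⇒2≤length {xs = _ ∷ _ ∷ _} (here _)  (there _) _   = ℕ.s≤s (ℕ.s≤s ℕ.z≤n)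
distinct-∈⇒2≤length {xs = _ ∷ _ ∷ _} (there _) _         _   = ℕ.s≤s (ℕ.s≤s ℕ.z≤n)

-- Natural-valued ultrametrics and the heights of a hierarchy.

record IsUltrametricℕ {n} (v : Fin n → Fin n → ℕ) : Set where
  field
    ≡⇒0        : ∀ x → v x x ≡ 0
    0⇒≡        : ∀ {x y} → v x y ≡ 0 → x ≡ y
    symmetric  : ∀ x y → v x y ≡ v y x
    ultra      : ∀ x y z → v x z ℕ.≤ v x y ℕ.⊔ v y z

module _ {n : ℕ} (H : Hierarchy n) where

  open Hierarchy H

  leaves-unique : Unique (leaves tree)
  leaves-unique = Unique-resp-↭ (↭.↭-sym leaves↭) (allFin⁺ n)

  ∈-leaves : ∀ x → x ∈ leaves tree
  ∈-leaves x = ↭.∈-resp-↭ (↭.↭-sym leaves↭) (∈-allFin x)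

  ∣tree∣≡n : ∣ tree ∣ ≡ n
  ∣tree∣≡n = ≡.trans (↭.↭-length leaves↭) (List.length-tabulate id)

  height≤n : ∀ x y → height H x y ℕ.≤ n
  height≤n x y with x Fin.≟ y
  ... | yes _ = ℕ.z≤n
  ... | no  _ = ℕ.≤-trans (ℕ.m∸n≤m _ 1) (ℕ.≤-trans (∣lca∣≤∣t∣ tree x y) (ℕ.≤-reflexive ∣tree∣≡n))

  -- The cluster contains the two distinct vertices, so its size stays positive after `∸ 1`.
  height≥1 : ∀ {x y} → x ≢ y → 1 ℕ.≤ height H x y
  height≥1 {x} {y} x≢y rewrite heightᵗ-≢ tree x≢y
    with x∈ , y∈ ← ∈-lca tree leaves-unique (∈-leaves x) (∈-leaves y) =
    ℕ.∸-monoˡ-≤ 1 (distinct-∈⇒2≤length x∈ y∈ x≢y)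

  height-isUltrametricℕ : IsUltrametricℕ (height H)
  height-isUltrametricℕ = record
    { ≡⇒0       = heightᵗ-refl tree
    ; 0⇒≡       = 0⇒≡
    ; symmetric = symmetric
    ; ultra     = ultra
    }
    where
    0⇒≡ : ∀ {x y} → height H x y ≡ 0 → x ≡ y
    0⇒≡ {x} {y} h≡0 with x Fin.≟ y in eq
    ... | yes x≡y = x≡y
    ... | no  x≢y with () ← ≡.subst (1 ℕ.≤_) (≡.trans (heightᵗ-≢ tree x≢y) h≡0) (height≥1 x≢y)

    symmetric : ∀ x y → height H x y ≡ height H y x
    symmetric x y with x Fin.≟ y
    ... | yes ≡.refl = ≡.sym (heightᵗ-refl tree x)
    ... | no  x≢y    = ≡.trans (≡.cong (λ t → ∣ t ∣ ∸ 1) (lca-sym tree x y))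
                               (≡.sym (heightᵗ-≢ tree (x≢y ∘ ≡.sym)))

    ultra : ∀ x y z → height H x z ℕ.≤ height H x y ℕ.⊔ height H y z
    ultra x y z = by-cases (x Fin.≟ y) (y Fin.≟ z) (x Fin.≟ z)
      where
      by-cases : Dec (x ≡ y) → Dec (y ≡ z) → Dec (x ≡ z) → height H x z ℕ.≤ height H x y ℕ.⊔ height H y z
      by-cases (yes ≡.refl) _            _            = ℕ.m≤n⊔m _ _
      by-cases _            (yes ≡.refl) _            = ℕ.m≤m⊔n _ _
      by-cases _            _            (yes ≡.refl) rewrite heightᵗ-refl tree x = ℕ.z≤n
      by-cases (no x≢y)     (no y≢z)     (no x≢z)
        rewrite heightᵗ-≢ tree x≢y | heightᵗ-≢ tree y≢z | heightᵗ-≢ tree x≢z =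
        ℕ.≤-trans
          (ℕ.∸-monoˡ-≤ 1 (∣lca∣-ultra tree leaves-unique (∈-leaves x) (∈-leaves y) (∈-leaves z)))
          (ℕ.≤-reflexive (ℕ.∸-distribʳ-⊔ 1 ∣ lca tree x y ∣ ∣ lca tree y z ∣))

-- Walks inside clusters and cuts at a single vertex.

module Walks {n : ℕ} (_~_ : Rel (Fin n) 0ℓ) (~-sym : Symmetric _~_) where

  private
    variable
      v w x y : Fin n
      X : List (Fin n)

  -- A local certificate of feasibility: when leaves are distinct, the chosen edges below a node
  -- form a spanning tree of its cluster.
  Linked : Tree ⊤ (Fin n) → Set
  Linked (leaf _)     = ⊤
  Linked (node l m r) = Linked l × Linked r × ∃[ x ] ∃[ y ] (x ∈ leaves l × y ∈ leaves r × x ~ y)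

  -- The same fold as `walkLength`, hence definitionally equal to it, for a bare relation.
  steps : Star _~_ x y → ℕ
  steps = Star.fold (λ _ _ → ℕ) (λ _ k → suc k) 0

  steps-◅◅ : (p : Star _~_ x y) (q : Star _~_ y v) → steps (p ◅◅ q) ≡ steps p ℕ.+ steps q
  steps-◅◅ ε       q = ≡.refl
  steps-◅◅ (_ ◅ p) q = ≡.cong suc (steps-◅◅ p q)

  -- Leaves in different children are joined through the crossing edge. Both partial walks obey
  -- strict bounds, which leaves room for that one extra step.
  Linked⇒walk : ∀ t → Linked t → x ∈ leaves t → y ∈ leaves t →
                ∃[ p ] steps {x} {y} p ℕ.< ∣ t ∣
  Linked⇒walk (leaf v)     _ (here ≡.refl) (here ≡.refl) = ε , ℕ.≤-refl
  Linked⇒walk (node l m r) (Ll , Lr , u , v , u∈l , v∈r , u~v) x∈ y∈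
    rewrite ∣node∣ l {m} r = by-cases (∈-node⁻ l {m} r x∈) (∈-node⁻ l {m} r y∈)
    where
    join : ∀ {x u v y i j} (p : Star _~_ x u) (e : u ~ v) (q : Star _~_ v y) →
           steps p ℕ.< i → steps q ℕ.< j → steps (p ◅◅ e ◅ q) ℕ.< i ℕ.+ j
    join p e q p<i q<j rewrite steps-◅◅ p (e ◅ q) = ℕ.+-mono-≤ p<i q<j

    by-cases : ∀ {x y} → x ∈ leaves l ⊎ x ∈ leaves r → y ∈ leaves l ⊎ y ∈ leaves r →
               ∃[ p ] steps {x} {y} p ℕ.< ∣ l ∣ ℕ.+ ∣ r ∣
    by-cases (inj₁ x∈l) (inj₁ y∈l) with p , p< ← Linked⇒walk l Ll x∈l y∈l =
      p , ℕ.<-≤-trans p< (ℕ.m≤m+n _ _)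
    by-cases (inj₂ x∈r) (inj₂ y∈r) with p , p< ← Linked⇒walk r Lr x∈r y∈r =
      p , ℕ.<-≤-trans p< (ℕ.m≤n+m _ _)
    by-cases (inj₁ x∈l) (inj₂ y∈r)
      with p , p< ← Linked⇒walk l Ll x∈l u∈l | q , q< ← Linked⇒walk r Lr v∈r y∈r =
      p ◅◅ u~v ◅ q , join p u~v q p< q<
    by-cases (inj₂ x∈r) (inj₁ y∈l)
      with p , p< ← Linked⇒walk r Lr x∈r v∈r | q , q< ← Linked⇒walk l Ll u∈l y∈l =
      p ◅◅ ~-sym u~v ◅ q ,
      ≡.subst (steps (p ◅◅ ~-sym u~v ◅ q) ℕ.<_) (ℕ.+-comm ∣ r ∣ ∣ l ∣) (join p (~-sym u~v) q p< q<)

  -- The walk is taken for the subtree at the lowest common ancestor, which inherits `Linked`; being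
  -- shorter than the cluster size means being at most the height.
  height-walk : (H : Hierarchy n) → Linked (Hierarchy.tree H) → ∀ x y →
                ∃[ p ] steps {x} {y} p ℕ.≤ height H x y
  height-walk H L x y with x Fin.≟ y
  ... | yes ≡.refl = ε , ℕ.z≤n
  ... | no  _
    with x∈ , y∈ ← ∈-lca (Hierarchy.tree H) (leaves-unique H) (∈-leaves H x) (∈-leaves H y)
    with p , p< ← Linked⇒walk _ (lca-preserves Linked (λ (Ll , Lr , _) → Ll , Lr) (Hierarchy.tree H) x y L) x∈ y∈ =
    p , ℕ.∸-monoˡ-≤ 1 p<

  Within : List (Fin n) → Rel (Fin n) 0ℓ
  Within X x y = x ∈ X × y ∈ X × x ~ y

  Connectedˡ : List (Fin n) → Set
  Connectedˡ X = ∀ {x y} → x ∈ X → y ∈ X → Star (Within X) x y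

  private
    Within-sym : Symmetric (Within X)
    Within-sym (x∈ , y∈ , x~y) = y∈ , x∈ , ~-sym x~y

  Connectedˡ-∷ : x ∈ X → x ~ y → Connectedˡ X → Connectedˡ (y ∷ X)
  Connectedˡ-∷ {x} {X} {y} x∈X x~y conn = connected
    where
    extend : ∀ {u w} → Star (Within X) u w → Star (Within (y ∷ X)) u w
    extend = Star.map λ (u∈ , w∈ , u~w) → there u∈ , there w∈ , u~w

    edge : Within (y ∷ X) x y
    edge = there x∈X , here ≡.refl , x~y

    connected : Connectedˡ (y ∷ X)
    connected (here ≡.refl) (here ≡.refl) = ε
    connected (here ≡.refl) (there w∈)    = Within-sym edge ◅ extend (conn x∈X w∈)
    connected (there u∈)    (here ≡.refl) = extend (conn u∈ x∈X) ◅◅ edge ◅ ε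
    connected (there u∈)    (there w∈)    = extend (conn u∈ w∈)

  -- A bipartition inner | v ∷ outer all of whose cut edges end at v.
  record Cut (X : List (Fin n)) (v : Fin n) : Set where
    field
      inner outer : List (Fin n)
      cut↭        : inner ++ v ∷ outer ↭ X
      root        : Fin n
      root∈       : root ∈ inner
      inner-conn  : Connectedˡ inner
      no-edge     : x ∈ inner → y ∈ outer → ¬ (x ~ y)

  module _ (_~?_ : Decidable _~_) where

    -- The connected list `Y` absorbs one neighbour from `Z` at a time. When none is left, `Y` is
    -- the component of its starting vertex after deletion of `v`. The number `k` bounds `Z` and
    -- makes the recursion structural.
    cut-grow : ∀ k {x} Y Z → length Z ℕ.≤ k → x ∈ Y → Connectedˡ Y → Y ++ v ∷ Z ↭ X → Cut X v
    cut-grow {v} {X} k Y Z |Z|≤k x∈Y connY ↭X with any? (λ y → any? (y ~?_) Z) Y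
    ... | no none = record
      { inner      = Y
      ; outer      = Z
      ; cut↭       = ↭X
      ; root∈      = x∈Y
      ; inner-conn = connY
      ; no-edge    = λ y∈Y z∈Z y~z → none (lose y∈Y (lose z∈Z y~z))
      }
    ... | yes some
      with y , y∈Y , some′ ← find some
      with z , z∈Z , y~z ← find some′
      with Z₁ , Z₂ , ≡.refl ← ∈-∃++ z∈Z
      -- `Z` contains `z`, so the case `k = 0` is impossible.
      with k | ≡.subst (ℕ._≤ k) (↭.↭-length (↭.shift z Z₁ Z₂)) |Z|≤k
    ...   | suc k′ | ℕ.s≤s |Z|≤k′ =
      cut-grow k′ (z ∷ Y) (Z₁ ++ Z₂) |Z|≤k′ (here ≡.refl) (Connectedˡ-∷ y∈Y y~z connY)
        (↭.trans (↭.↭-sym (↭.trans (↭.++⁺ˡ Y (↭.shift z (v ∷ Z₁) Z₂)) (↭.shift z Y (v ∷ Z₁ ++ Z₂)))) ↭X)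

    -- Growth starts from the first entry that remains after one occurrence of `v` is removed.
    cut : v ∈ X → 2 ℕ.≤ length X → Cut X v
    cut {v} v∈X 2≤|X| with X₁ , X₂ , ≡.refl ← ∈-∃++ v∈X
      with X₁ ++ X₂ | ↭.shift v X₁ X₂
    ... | []    | p with ℕ.s≤s () ← ≡.subst (2 ℕ.≤_) (↭.↭-length p) 2≤|X|
    ... | x ∷ Z | p = cut-grow (length Z) [ x ] Z ℕ.≤-refl (here ≡.refl)
      (λ where (here ≡.refl) (here ≡.refl) → ε)
      (↭.trans (↭.swap x v ↭.refl) (↭.↭-sym p))

  module _ (C : Cut X v) (X-conn : Connectedˡ X) (X-unique : Unique X) where
    open Cut C

    private
      split : x ∈ X → x ∈ inner ⊎ x ∈ v ∷ outer
      split = ∈-++⁻ inner ∘ ↭.∈-resp-↭ (↭.↭-sym cut↭)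

      inner⊆X : x ∈ inner → x ∈ X
      inner⊆X = ↭.∈-resp-↭ cut↭ ∘ ∈-++⁺ˡ

      outer⊆X : x ∈ v ∷ outer → x ∈ X
      outer⊆X = ↭.∈-resp-↭ cut↭ ∘ ∈-++⁺ʳ inner

      v∉inner : v ∉ inner
      v∉inner v∈ = proj₂ (proj₂ (Unique-++⁻ inner (Unique-resp-↭ (↭.↭-sym cut↭) X-unique))) (v∈ , here ≡.refl)

    -- A walk in `X` from `outer` to `v` cannot enter `inner` before it meets `v`, by `no-edge`;
    -- stopped there, it stays in `v ∷ outer`. Two such walks are joined at `v`.
    outer-conn : Connectedˡ (v ∷ outer)
    outer-conn x∈ y∈ = toCut x∈ (X-conn (outer⊆X x∈) v∈X) ◅◅
      Star.reverse Within-sym (toCut y∈ (X-conn (outer⊆X y∈) v∈X))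
      where
      v∈X = outer⊆X (here ≡.refl)

      toCut : w ∈ v ∷ outer → Star (Within X) w v → Star (Within (v ∷ outer)) w v
      toCut w∈            ε = ε
      toCut (here ≡.refl) _ = ε
      toCut (there w∈)    ((_ , u∈X , w~u) ◅ p) with split u∈X
      ... | inj₁ u∈ = contradiction (~-sym w~u) (no-edge u∈ w∈)
      ... | inj₂ u∈ = (there w∈ , u∈ , w~u) ◅ toCut u∈ p

    -- A walk in `X` from `root` to `v` must leave `inner`, and by `no-edge` its first step outside
    -- cannot land in `outer`.
    crossing-edge : ∃[ x ] (x ∈ inner × x ~ v)
    crossing-edge = search root∈ (X-conn (inner⊆X root∈) (outer⊆X (here ≡.refl)))
      where
      search : w ∈ inner → Star (Within X) w v → ∃[ x ] (x ∈ inner × x ~ v)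
      search w∈ ε = contradiction w∈ v∉inner
      search {w} w∈ ((_ , u∈X , w~u) ◅ p) with split u∈X
      ... | inj₁ u∈             = search u∈ p
      ... | inj₂ (here ≡.refl)  = w , w∈ , w~u
      ... | inj₂ (there u∈)     = contradiction w~u (no-edge w∈ u∈)

-- Finite choice, least witnesses and a sample tree.

-- Finitely many classical choices can be made one after another. Applied twice, it selects the
-- integer parts of all entries of a matrix.
¬¬-∀Fin : ∀ {P : Fin n → Set p} → (∀ i → ¬ ¬ P i) → ¬ ¬ (∀ i → P i)
¬¬-∀Fin {n = zero}  ¬¬P = return λ ()
¬¬-∀Fin {n = suc n} ¬¬P = do
  P₀ ← ¬¬P zero
  Pₛ ← ¬¬-∀Fin (¬¬P ∘ suc)
  return λ where
    zero    → P₀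
    (suc i) → Pₛ i

-- If no witness were least, strong induction would refute `P` at every number, since all smaller
-- witnesses are already excluded.
least : ∀ (P : ℕ → Set p) {k} → P k → ¬ ¬ (∃[ j ] (P j × (∀ i → P i → j ℕ.≤ i)))
least P {k} Pk ¬least = <-rec (λ k → ¬ P k)
  (λ k rec Pk → ¬least (k , Pk , λ i Pi → ℕ.≮⇒≥ λ i<k → rec i<k Pi)) k Pk

-- A caterpillar. It supplies one concrete hierarchy for the complete graph, where all hierarchies
-- cost the same.
fromList : A → List A → Tree ⊤ A
fromList x []       = leaf x
fromList x (y ∷ ys) = node (leaf x) tt (fromList y ys)

leaves-fromList : ∀ (x : Fin n) xs → leaves (fromList x xs) ≡ x ∷ xs
leaves-fromList x []       = ≡.refl
leaves-fromList x (y ∷ ys) = ≡.cong (x ∷_) (leaves-fromList y ys)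

module Main {c ℓ₁ ℓ₂} (R : Reals c ℓ₁ ℓ₂) where

  open RealsProperties R
  open Optimisation R

  -- Double sums, cut weights and the cost of a tree.

  module _ {X : Set a} where

    ∑∑ : List X → List X → (X → X → Carrier) → Carrier
    ∑∑ xs ys f = ∑[ x ∈ xs ] ∑[ y ∈ ys ] f x y

    ∑∑-cong : ∀ {f g} xs ys → (∀ {x y} → x ∈ xs → y ∈ ys → f x y ≈ g x y) → ∑∑ xs ys f ≈ ∑∑ xs ys g
    ∑∑-cong xs ys f≈g = ∑-cong xs λ x∈ → ∑-cong ys λ y∈ → f≈g x∈ y∈

    ∑∑-mono : ∀ {f g} xs ys → (∀ {x y} → x ∈ xs → y ∈ ys → f x y ≤ g x y) → ∑∑ xs ys f ≤ ∑∑ xs ys g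
    ∑∑-mono xs ys f≤g = ∑-mono xs λ x∈ → ∑-mono ys λ y∈ → f≤g x∈ y∈

    ∑∑-↭ : ∀ {f xs xs′ ys ys′} → xs ↭ xs′ → ys ↭ ys′ → ∑∑ xs ys f ≈ ∑∑ xs′ ys′ f
    ∑∑-↭ {xs′ = xs′} p q = trans (∑-↭ p) (∑-cong xs′ λ _ → ∑-↭ q)

    ∑∑-*ˡ : ∀ {f} k xs ys → ∑∑ xs ys (λ x y → k * f x y) ≈ k * ∑∑ xs ys f
    ∑∑-*ˡ k xs ys = trans (∑-cong xs λ _ → ∑-*ˡ k ys) (∑-*ˡ k xs)

    -- The weight of a cut. Both orders are added because the weight matrix will record each edge in
    -- only one of its two orientations.
    cross : (X → X → Carrier) → List X → List X → Carrier
    cross f xs ys = ∑∑ xs ys f + ∑∑ ys xs f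

    ∑∑-++ : ∀ {f} xs ys → ∑∑ (xs ++ ys) (xs ++ ys) f ≈ ∑∑ xs xs f + ∑∑ ys ys f + cross f xs ys
    ∑∑-++ {f} xs ys = begin
      ∑∑ (xs ++ ys) (xs ++ ys) f                                  ≈⟨ ∑-++ xs ⟩
      ∑∑ xs (xs ++ ys) f + ∑∑ ys (xs ++ ys) f                     ≈⟨ +-cong (block xs) (block ys) ⟩
      (∑∑ xs xs f + ∑∑ xs ys f) + (∑∑ ys xs f + ∑∑ ys ys f)       ≈⟨ rearrange _ _ _ _ ⟩
      ∑∑ xs xs f + ∑∑ ys ys f + cross f xs ys                     ∎
      where
      open import Relation.Binary.Reasoning.Setoid setoid
      block : ∀ zs → ∑∑ zs (xs ++ ys) f ≈ ∑∑ zs xs f + ∑∑ zs ys f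
      block zs = trans (∑-cong zs λ _ → ∑-++ xs) (∑-+ zs)
      rearrange : ∀ a b c d → (a + b) + (c + d) ≈ a + d + (b + c)
      rearrange = solve 4 (λ a b c d → (a :+ b) :+ (c :+ d) := a :+ d :+ (b :+ c)) refl

    degree : (X → X → Carrier) → List X → X → Carrier
    degree f xs v = ∑[ x ∈ xs ] (f x v + f v x)

    -- Both sides count every pair in xs × xs twice.
    ∑-degree : ∀ {f} xs → ∑ xs (degree f xs) ≈ fromℕ 2 * ∑∑ xs xs f
    ∑-degree {f} xs = begin
      ∑ xs (degree f xs)                                            ≈⟨ ∑-cong xs (λ _ → ∑-+ xs) ⟩
      ∑[ v ∈ xs ] (∑[ x ∈ xs ] f x v + ∑[ x ∈ xs ] f v x)           ≈⟨ ∑-+ xs ⟩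
      (∑[ v ∈ xs ] ∑[ x ∈ xs ] f x v) + ∑∑ xs xs f                  ≈⟨ +-congʳ (∑-swap xs xs) ⟩
      ∑∑ xs xs f + ∑∑ xs xs f                                       ≈⟨ double _ ⟩
      fromℕ 2 * ∑∑ xs xs f                                          ∎
      where
      open import Relation.Binary.Reasoning.Setoid setoid
      double : ∀ s → s + s ≈ fromℕ 2 * s
      double = solve 1 (λ s → s :+ s := #2 :* s) refl

  -- The hierarchy cost regrouped by internal nodes: every pair is charged at its lowest common
  -- ancestor, with cluster size minus one as the factor.
  treeCost : (Fin n → Fin n → Carrier) → Tree ⊤ (Fin n) → Carrier
  treeCost T (leaf _)     = 0#
  treeCost T (node l _ r) =
    treeCost T l + treeCost T r + fromℕ (∣ l ∣ ℕ.+ ∣ r ∣ ∸ 1) * cross T (leaves l) (leaves r)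

  -- The double sum splits into four blocks. Within a child the lowest common ancestor is that of
  -- the child; across, it is the node itself.
  ∑∑-heightᵗ : ∀ (T : Fin n → Fin n → Carrier) t → Unique (leaves t) →
               ∑∑ (leaves t) (leaves t) (λ x y → T x y * fromℕ (heightᵗ t x y)) ≈ treeCost T t
  ∑∑-heightᵗ T (leaf x) u rewrite heightᵗ-refl (leaf x) x =
    trans (+-identityʳ _) (trans (+-identityʳ _) (zeroʳ _))
  ∑∑-heightᵗ {n = n} T (node l m r) u with ul , ur , disj ← Unique-node⁻ l {m} r u = begin
    ∑∑ (leaves t) (leaves t) (λ x y → T x y * h t x y)
      ≡⟨ ≡.cong (λ xs → ∑∑ xs xs (λ x y → T x y * h t x y)) (leaves-node l r) ⟩
    ∑∑ (L ++ M) (L ++ M) (λ x y → T x y * h t x y)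
      ≈⟨ ∑∑-++ L M ⟩
    ∑∑ L L (λ x y → T x y * h t x y) + ∑∑ M M (λ x y → T x y * h t x y) + cross (λ x y → T x y * h t x y) L M
      ≈⟨ +-cong (+-cong left right) across ⟩
    treeCost T t ∎
    where
    open import Relation.Binary.Reasoning.Setoid setoid
    t = node l m r
    L = leaves l
    M = leaves r
    h : Tree ⊤ (Fin n) → Fin n → Fin n → Carrier
    h t x y = fromℕ (heightᵗ t x y)
    D = fromℕ (∣ l ∣ ℕ.+ ∣ r ∣ ∸ 1)

    h-lca : ∀ {x y} s → lca t x y ≡ lca s x y → T x y * h t x y ≈ T x y * h s x y
    h-lca {x} {y} s eq with x Fin.≟ y
    ... | yes _ = refl
    ... | no  _ = *-congˡ (reflexive (≡.cong (λ s → fromℕ (∣ s ∣ ∸ 1)) eq))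

    h-across : ∀ {x y} → x ≢ y → lca t x y ≡ t → T x y * h t x y ≈ D * T x y
    h-across {x} {y} x≢y eq rewrite heightᵗ-≢ t x≢y | eq | ∣node∣ l {m} r = *-comm _ _

    left : ∑∑ L L (λ x y → T x y * h t x y) ≈ treeCost T l
    left = trans (∑∑-cong L L λ x∈ y∈ → h-lca l (lca-left l r disj x∈ y∈)) (∑∑-heightᵗ T l ul)

    right : ∑∑ M M (λ x y → T x y * h t x y) ≈ treeCost T r
    right = trans (∑∑-cong M M λ x∈ y∈ → h-lca r (lca-right l r disj x∈ y∈)) (∑∑-heightᵗ T r ur)

    across : cross (λ x y → T x y * h t x y) L M ≈ D * cross T L M
    across = trans
      (+-cong
        (trans (∑∑-cong L M λ x∈l y∈r → h-across (λ where ≡.refl → disj (x∈l , y∈r)) (lca-acrossˡ l r disj x∈l y∈r))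
               (∑∑-*ˡ D L M))
        (trans (∑∑-cong M L λ x∈r y∈l → h-across (λ where ≡.refl → disj (y∈l , x∈r)) (lca-acrossʳ l r disj x∈r y∈l))
               (∑∑-*ˡ D M L)))
      (sym (distribˡ D _ _))

  -- Passing between natural-valued and real-valued ultrametrics.

  fromℕ-isUltrametric : ∀ {v : Fin n → Fin n → ℕ} → IsUltrametricℕ v → IsUltrametric (λ x y → fromℕ (v x y))
  fromℕ-isUltrametric {v = v} V = record
    { isMetric = record
      { isSemiMetric = record
        { isQuasiSemiMetric = record
          { isPreMetric = record
            { isProtoMetric = record
              { isPartialOrder  = ≤-isPartialOrder
              ; ≈-isEquivalence = ≡.isEquivalence
              ; cong            = λ x≡x′ y≡y′ → reflexive (≡.cong₂ (λ x y → fromℕ (v x y)) x≡x′ y≡y′)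
              ; nonNegative     = λ {x} {y} → fromℕ-nonNeg (v x y)
              }
            ; ≈⇒0 = λ {x} x≡y → reflexive (≡.cong fromℕ (≡.subst (λ y → v x y ≡ 0) x≡y (≡⇒0 x)))
            }
          ; 0⇒≈ = λ eq → 0⇒≡ (fromℕ≈0⇒≡0 _ eq)
          }
        ; sym = λ x y → reflexive (≡.cong fromℕ (symmetric x y))
        }
      ; triangle = λ x y z → ≤-trans (ultraℝ x y z) (⊔-lub (x≤x+y _ (fromℕ-nonNeg (v y z))) (x≤y+x _ (fromℕ-nonNeg (v x y))))
      }
    ; ultratriangle = ultraℝ
    }
    where
    open IsUltrametricℕ V
    ultraℝ : ∀ x y z → fromℕ (v x z) ≤ fromℕ (v x y) ⊔ fromℕ (v y z)
    ultraℝ x y z with ℕ.⊔-sel (v x y) (v y z) | ultra x y z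
    ... | inj₁ eq | le rewrite eq = ≤-trans (fromℕ-mono le) (x≤x⊔y _ _)
    ... | inj₂ eq | le rewrite eq = ≤-trans (fromℕ-mono le) (y≤x⊔y _ _)

  -- Truncated at D, so that it is one of finitely many values.
  IsFloor : ℕ → Carrier → ℕ → Set ℓ₂
  IsFloor D x k = k ℕ.≤ D × fromℕ k ≤ x × (∀ j → j ℕ.≤ D → fromℕ j ≤ x → j ℕ.≤ k)

  -- The search descends from `D`: either `suc D` is below `x` and is the answer, or it is ruled out
  -- as a competitor and the answer for `D` remains greatest.
  floor-exists : ∀ D {x} → 0# ≤ x → ¬ ¬ (∃[ k ] IsFloor D x k)
  floor-exists zero    0≤x = return (0 , ℕ.z≤n , 0≤x , λ _ j≤0 _ → j≤0)
  floor-exists (suc D) {x} 0≤x = do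
    inj₂ D+1≰x ← excluded-middle (fromℕ (suc D) ≤ x)
      where inj₁ D+1≤x → return (suc D , ℕ.≤-refl , D+1≤x , λ _ j≤ _ → j≤)
    k , k≤D , k≤x , greatest ← floor-exists D 0≤x
    return (k , ℕ.m≤n⇒m≤1+n k≤D , k≤x , λ j j≤D+1 j≤x →
      [ (λ j<D+1 → greatest j (ℕ.s≤s⁻¹ j<D+1) j≤x) , (λ where ≡.refl → contradiction j≤x D+1≰x) ]′
        (ℕ.m≤n⇒m<n∨m≡n j≤D+1))

  -- Cost and total weight of a graph.

  module _ {n : ℕ} (G : WeightedGraph n) where

    open WeightedGraph G

    private
      edgeWeight : ∀ {x y} → Dec (x Fin.< y) → Dec (x ~ y) → Carrier
      edgeWeight (yes _) (yes e) = weight e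
      edgeWeight _       _       = 0#

    -- Supported on the pairs x < y, as in cost.
    T : Fin n → Fin n → Carrier
    T x y = edgeWeight (x Fin.<? y) (x ~? y)

    T-nonNeg : ∀ x y → 0# ≤ T x y
    T-nonNeg x y with x Fin.<? y | x ~? y
    ... | yes _ | yes e = <⇒≤ (weight-pos e)
    ... | yes _ | no  _ = ≤-refl
    ... | no  _ | _     = ≤-refl

    T-≁ : ∀ {x y} → ¬ (x ~ y) → T x y ≈ 0#
    T-≁ {x} {y} x≁y with x Fin.<? y | x ~? y
    ... | yes _ | yes e = contradiction e x≁y
    ... | yes _ | no  _ = refl
    ... | no  _ | _     = refl

    T-pos : ∀ {x y} → x Fin.< y → x ~ y → 0# < T x y
    T-pos {x} {y} x<y x~y with x Fin.<? y | x ~? y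
    ... | yes _  | yes e  = weight-pos e
    ... | yes _  | no x≁y = contradiction x~y x≁y
    ... | no x≮y | _      = contradiction x<y x≮y

    mutual
      cost≈sum : ∀ u → cost G u ≈ sum λ x → sum λ y → T x y * u x y
      cost≈sum u = sum-cong-≋ λ x → sum-cong-≋ λ y → term≈ u x y

      -- The left-hand side is the local summand of cost, which has no name.
      term≈ : ∀ u x y → _ ≈ T x y * u x y
      term≈ u x y with x Fin.<? y | x ~? y
      ... | yes _ | yes _ = refl
      ... | yes _ | no  _ = sym (zeroˡ _)
      ... | no  _ | _     = sym (zeroˡ _)

    cost≈∑∑ : ∀ u → cost G u ≈ ∑∑ (allFin n) (allFin n) (λ x y → T x y * u x y)
    cost≈∑∑ u = trans (cost≈sum u) (trans
      (reflexive (sum≡∑ (λ x → sum λ y → T x y * u x y) id))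
      (∑-cong (allFin n) λ {x} _ → reflexive (sum≡∑ (λ y → T x y * u x y) id)))

    total : Carrier
    total = ∑∑ (allFin n) (allFin n) T

    cost-mono : ∀ {u u′} → (∀ x y → u x y ≤ u′ x y) → cost G u ≤ cost G u′
    cost-mono {u} {u′} u≤u′ = begin
      cost G u                                             ≈⟨ cost≈∑∑ u ⟩
      ∑∑ (allFin n) (allFin n) (λ x y → T x y * u x y)     ≤⟨ ∑∑-mono (allFin n) (allFin n)
                                                                (λ {x} {y} _ _ → *-monoʳ-≤ (T-nonNeg x y) (u≤u′ x y)) ⟩
      ∑∑ (allFin n) (allFin n) (λ x y → T x y * u′ x y)    ≈⟨ cost≈∑∑ u′ ⟨
      cost G u′                                            ∎
      where open ≤-Reasoning

    cost-cong : ∀ {u u′} → (∀ x y → u x y ≈ u′ x y) → cost G u ≈ cost G u′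
    cost-cong u≈u′ = ≤-antisym (cost-mono λ x y → ≤-reflexive (u≈u′ x y))
                               (cost-mono λ x y → ≤-reflexive (sym (u≈u′ x y)))

    cost-height : ∀ H → cost G (heightℝ H) ≈ treeCost T (Hierarchy.tree H)
    cost-height H = trans (cost≈∑∑ (heightℝ H))
      (trans (∑∑-↭ (↭.↭-sym leaves↭) (↭.↭-sym leaves↭)) (∑∑-heightᵗ T tree (leaves-unique H)))
      where open Hierarchy H

    isDistance-edge : ∀ {x y} → x ~ y → IsDistance G x y 1
    isDistance-edge x~y = (x~y ◅ ε , ≡.refl) , λ where
      ε       → contradiction x~y (~-irrefl ≡.refl)
      (_ ◅ _) → ℕ.s≤s ℕ.z≤n

    -- Adjacent vertices are at distance 1, so the comparison holds entry by entry; off the edges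
    -- both entries vanish.
    total≤cost : ∀ {u} → DominatesDistance G u → total ≤ cost G u
    total≤cost {u} dom = ≤-trans (∑∑-mono (allFin n) (allFin n) λ {x} {y} _ _ → T≤Tu x y)
                                 (≤-reflexive (sym (cost≈∑∑ u)))
      where
      T≤Tu : ∀ x y → T x y ≤ T x y * u x y
      T≤Tu x y = by-cases (x ~? y)
        where
        by-cases : Dec (x ~ y) → T x y ≤ T x y * u x y
        by-cases (no x≁y) = ≤-reflexive (trans (T-≁ x≁y) (sym (trans (*-congʳ (T-≁ x≁y)) (zeroˡ _))))
        by-cases (yes x~y) = begin
          T x y            ≈⟨ *-identityʳ _ ⟨
          T x y * 1#       ≈⟨ *-congˡ (+-identityʳ 1#) ⟨
          T x y * fromℕ 1  ≤⟨ *-monoʳ-≤ (T-nonNeg x y) (dom x y 1 (isDistance-edge x~y)) ⟩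
          T x y * u x y    ∎
          where open ≤-Reasoning

    -- A walk from vertex 0 to vertex 1 begins with an edge at 0. As 0 is the least vertex, `T`
    -- records this edge in the orientation of the walk.
    total-pos : 2 ℕ.≤ n → Connected G → 0# < total
    total-pos (ℕ.s≤s (ℕ.s≤s _)) conn with conn zero (suc zero)
    ... | _◅_ {j = zero}  e _ = contradiction e (~-irrefl ≡.refl)
    ... | _◅_ {j = suc w} e _ = <-≤-trans (T-pos (ℕ.s≤s ℕ.z≤n) e)
      (≤-trans (term≤∑ (∈-allFin (suc w)) (T-nonNeg zero))
               (term≤∑ (∈-allFin zero) (λ x → ∑-nonNeg (allFin n) (T-nonNeg x))))

    -- Recursive construction of a cheap feasible hierarchy.

    open Walks _~_ ~-sym

    private
      -- By `no-edge` only the pairs containing `v` contribute to the cut; enlarging the sum from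
      -- `inner` to `X` adds nonnegative terms.
      degree-bound : ∀ {X v} → (C : Cut X v) → let open Cut C in
                     cross T inner (v ∷ outer) ≤ degree T X v
      degree-bound {X} {v} C = begin
        cross T inner (v ∷ outer)
          ≈⟨ +-cong (∑-cong inner λ x∈ → trans (+-congˡ (∑-zero outer λ y∈ → T-≁ (no-edge x∈ y∈))) (+-identityʳ _))
                    (trans (+-congˡ (∑-zero outer λ y∈ → ∑-zero inner λ x∈ → T-≁ (no-edge x∈ y∈ ∘ ~-sym))) (+-identityʳ _)) ⟩
        (∑[ x ∈ inner ] T x v) + (∑[ x ∈ inner ] T v x)
          ≈⟨ ∑-+ inner ⟨
        degree T inner v
          ≤⟨ x≤x+y _ (∑-nonNeg (v ∷ outer) T²-nonNeg) ⟩
        degree T inner v + degree T (v ∷ outer) v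
          ≈⟨ ∑-++ inner ⟨
        degree T (inner ++ v ∷ outer) v
          ≈⟨ ∑-↭ cut↭ ⟩
        degree T X v ∎
        where
        open Cut C
        open ≤-Reasoning
        T²-nonNeg : ∀ x → 0# ≤ T x v + T v x
        T²-nonNeg x = ≤-trans (T-nonNeg x v) (x≤x+y _ (T-nonNeg v x))

      -- Here m = 2 + k: the bound 3 cost + W ≤ 2 m W is inherited from parts of
      -- at most m - 1 vertices whenever the cut weighs c ≤ 2 W / m.
      merge-bound : ∀ k i j {c₁ c₂ w₁ w₂ c W} → i ℕ.≤ suc k → j ℕ.≤ suc k →
                    0# ≤ w₁ → 0# ≤ w₂ → W ≈ w₁ + w₂ + c →
                    fromℕ 3 * c₁ + w₁ ≤ fromℕ 2 * fromℕ i * w₁ →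
                    fromℕ 3 * c₂ + w₂ ≤ fromℕ 2 * fromℕ j * w₂ →
                    fromℕ (2 ℕ.+ k) * c ≤ fromℕ 2 * W →
                    fromℕ 3 * (c₁ + c₂ + fromℕ (suc k) * c) + W ≤ fromℕ 2 * fromℕ (2 ℕ.+ k) * W
      merge-bound k i j {c₁} {c₂} {w₁} {w₂} {c} {W} i≤ j≤ 0≤w₁ 0≤w₂ W≈ b₁ b₂ bc = begin
        fromℕ 3 * (c₁ + c₂ + fromℕ (suc k) * c) + W
          ≈⟨ +-congˡ W≈ ⟩
        fromℕ 3 * (c₁ + c₂ + fromℕ (suc k) * c) + (w₁ + w₂ + c)
          -- The coefficient `3 (k + 1) + 1` of `c` is split as `2 (k + 1) + (k + 2)`: the first
          -- summand joins the induction hypotheses, the second is bounded by `bc`.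
          ≈⟨ lhs (fromℕ k) c₁ c₂ w₁ w₂ c ⟩
        (fromℕ 3 * c₁ + w₁) + (fromℕ 3 * c₂ + w₂) + (fromℕ 2 * fromℕ (suc k) * c + fromℕ (2 ℕ.+ k) * c)
          ≤⟨ +-mono-≤ (+-mono-≤ (weaken i≤ 0≤w₁ b₁) (weaken j≤ 0≤w₂ b₂)) (+-monoʳ-≤ _ bc) ⟩
        fromℕ 2 * fromℕ (suc k) * w₁ + fromℕ 2 * fromℕ (suc k) * w₂ + (fromℕ 2 * fromℕ (suc k) * c + fromℕ 2 * W)
          ≈⟨ collect (fromℕ 2 * fromℕ (suc k)) w₁ w₂ c (fromℕ 2 * W) ⟩
        fromℕ 2 * fromℕ (suc k) * (w₁ + w₂ + c) + fromℕ 2 * W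
          ≈⟨ +-congʳ (*-congˡ W≈) ⟨
        fromℕ 2 * fromℕ (suc k) * W + fromℕ 2 * W
          ≈⟨ rhs (fromℕ k) W ⟩
        fromℕ 2 * fromℕ (2 ℕ.+ k) * W ∎
        where
        open ≤-Reasoning

        weaken : ∀ {i x w} → i ℕ.≤ suc k → 0# ≤ w → x ≤ fromℕ 2 * fromℕ i * w → x ≤ fromℕ 2 * fromℕ (suc k) * w
        weaken i≤ 0≤w b = ≤-trans b (*-monoˡ-≤ 0≤w (*-monoʳ-≤ (fromℕ-nonNeg 2) (fromℕ-mono i≤)))

        lhs : ∀ k c₁ c₂ w₁ w₂ c → fromℕ 3 * (c₁ + c₂ + (1# + k) * c) + (w₁ + w₂ + c) ≈
              (fromℕ 3 * c₁ + w₁) + (fromℕ 3 * c₂ + w₂) + (fromℕ 2 * (1# + k) * c + (1# + (1# + k)) * c)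
        lhs = solve 6 (λ k c₁ c₂ w₁ w₂ c →
          #3 :* (c₁ :+ c₂ :+ (#1 :+ k) :* c) :+ (w₁ :+ w₂ :+ c) :=
          (#3 :* c₁ :+ w₁) :+ (#3 :* c₂ :+ w₂) :+ (#2 :* (#1 :+ k) :* c :+ (#1 :+ (#1 :+ k)) :* c)) refl

        collect : ∀ m w₁ w₂ c z → m * w₁ + m * w₂ + (m * c + z) ≈ m * (w₁ + w₂ + c) + z
        collect = solve 5 (λ m w₁ w₂ c z → m :* w₁ :+ m :* w₂ :+ (m :* c :+ z) := m :* (w₁ :+ w₂ :+ c) :+ z) refl

        rhs : ∀ k W → fromℕ 2 * (1# + k) * W + fromℕ 2 * W ≈ fromℕ 2 * (1# + (1# + k)) * W
        rhs = solve 2 (λ k W → #2 :* (#1 :+ k) :* W :+ #2 :* W := #2 :* (#1 :+ (#1 :+ k)) :* W) refl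

    -- With `m` vertices and weight `W` inside `X`, this is `treeCost ≤ (2 m - 1) W / 3`, cleared of
    -- division and subtraction.
    IsGoodTree : List (Fin n) → Tree ⊤ (Fin n) → Set ℓ₂
    IsGoodTree X t = fromℕ 3 * treeCost T t + ∑∑ X X T ≤ fromℕ 2 * fromℕ (length X) * ∑∑ X X T

    -- The parts of a cut are shorter than `X` but not structurally smaller, so `k` serves as fuel.
    -- The double negation stems from `averaging`, which selects the vertex to cut at.
    goodTree : ∀ k X → length X ℕ.≤ k → 1 ℕ.≤ length X → Unique X → Connectedˡ X →
               ¬ ¬ (∃[ t ] (leaves t ↭ X × Linked t × IsGoodTree X t))
    goodTree k (x ∷ []) _ _ _ _ = return (leaf x , ↭.refl , tt , good)
      where
      open ≤-Reasoning
      W = ∑∑ [ x ] [ x ] T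
      good : fromℕ 3 * 0# + W ≤ fromℕ 2 * fromℕ 1 * W
      good = begin
        fromℕ 3 * 0# + W       ≈⟨ trans (+-congʳ (zeroʳ _)) (+-identityˡ W) ⟩
        W                      ≤⟨ x≤x+y W (∑-nonNeg [ x ] λ y → ∑-nonNeg [ x ] (T-nonNeg y)) ⟩
        W + W                  ≈⟨ solve 1 (λ w → w :+ w := #2 :* (#1 :+ con 0) :* w) refl W ⟩
        fromℕ 2 * fromℕ 1 * W  ∎
    goodTree (suc k) X@(x ∷ x′ ∷ X′) |X|≤1+k _ unique conn = do
      v , v∈X , deg ← averaging X (here ≡.refl) (degree T X)
      split (cut _~?_ v∈X (ℕ.s≤s (ℕ.s≤s ℕ.z≤n))) deg
      where
      split : ∀ {v} → Cut X v →
              fromℕ (length X) * degree T X v ≤ ∑ X (degree T X) →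
              ¬ ¬ (∃[ t ] (leaves t ↭ X × Linked t × IsGoodTree X t))
      split {v} C deg = do
        l , l↭ , Ll , good-l ← goodTree k inner (bound |inner|≤) |inner|≥1 inner-unique inner-conn
        r , r↭ , Lr , good-r ← goodTree k (v ∷ outer) (bound |outer|≤) (ℕ.s≤s ℕ.z≤n) outer-unique (outer-conn C conn unique)
        return (node l tt r , leaves↭ l r l↭ r↭ , linked l r l↭ r↭ Ll Lr , good l r l↭ r↭ good-l good-r)
        where
        open Cut C

        |X|≡ : length inner ℕ.+ suc (length outer) ≡ length X
        |X|≡ = ≡.trans (≡.sym (List.length-++ inner)) (↭.↭-length cut↭)

        |inner|≥1 : 1 ℕ.≤ length inner
        |inner|≥1 with inner | root∈
        ... | _ ∷ _ | _ = ℕ.s≤s ℕ.z≤n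

        |inner|≤ : length inner ℕ.≤ suc (length X′)
        |inner|≤ = ℕ.s≤s⁻¹ (≡.subst (suc (length inner) ℕ.≤_) (≡.trans (≡.sym (ℕ.+-suc _ _)) |X|≡) (ℕ.s≤s (ℕ.m≤m+n _ _)))

        |outer|≤ : suc (length outer) ℕ.≤ suc (length X′)
        |outer|≤ = ℕ.s≤s⁻¹ (≡.subst (suc (suc (length outer)) ℕ.≤_) |X|≡ (ℕ.+-monoˡ-≤ _ |inner|≥1))

        bound : ∀ {i} → i ℕ.≤ suc (length X′) → i ℕ.≤ k
        bound i≤ = ℕ.≤-trans i≤ (ℕ.s≤s⁻¹ |X|≤1+k)

        unique′ = Unique-++⁻ inner (Unique-resp-↭ (↭.↭-sym cut↭) unique)
        inner-unique = proj₁ unique′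
        outer-unique = proj₁ (proj₂ unique′)

        module _ l r (l↭ : leaves l ↭ inner) (r↭ : leaves r ↭ v ∷ outer) where

          leaves↭ : leaves (node l tt r) ↭ X
          leaves↭ rewrite leaves-node l {tt} r = ↭.trans (↭.++⁺ l↭ r↭) cut↭

          linked : Linked l → Linked r → Linked (node l tt r)
          linked Ll Lr with x , x∈ , x~v ← crossing-edge C conn unique =
            Ll , Lr , x , v , ↭.∈-resp-↭ (↭.↭-sym l↭) x∈ , ↭.∈-resp-↭ (↭.↭-sym r↭) (here ≡.refl) , x~v

          good : IsGoodTree inner l → IsGoodTree (v ∷ outer) r → IsGoodTree X (node l tt r)
          good good-l good-r
            -- Once the cluster size reads `length X`, the `∸ 1` computes to `suc (length X′)`, the
            -- factor `suc k` of `merge-bound`.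
            rewrite ≡.trans (≡.cong₂ ℕ._+_ (↭.↭-length l↭) (↭.↭-length r↭)) |X|≡ = ≤-trans
              (≤-reflexive (+-congʳ (*-congˡ (+-congˡ (*-congˡ (+-cong (∑∑-↭ l↭ r↭) (∑∑-↭ r↭ l↭)))))))
              (merge-bound (length X′) (length inner) (length (v ∷ outer)) |inner|≤ |outer|≤
                (∑-nonNeg inner λ x → ∑-nonNeg inner (T-nonNeg x))
                (∑-nonNeg (v ∷ outer) λ x → ∑-nonNeg (v ∷ outer) (T-nonNeg x))
                (trans (∑∑-↭ (↭.↭-sym cut↭) (↭.↭-sym cut↭)) (∑∑-++ inner (v ∷ outer)))
                good-l good-r
                (≤-trans (*-monoʳ-≤ (fromℕ-nonNeg (length X)) (degree-bound C))
                  (≤-trans deg (≤-reflexive (∑-degree X)))))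

    -- Explicit walks give domination, and they also bound all distances by `n` where ultrametrics
    -- are truncated.
    ShortWalks : Hierarchy n → Set
    ShortWalks H = ∀ x y → ∃[ p ] walkLength G {x} {y} p ℕ.≤ height H x y

    ShortWalks⇒dominates : ∀ H → ShortWalks H → DominatesDistance G (heightℝ H)
    ShortWalks⇒dominates H walks x y k (_ , k-least) with p , p≤ ← walks x y =
      fromℕ-mono (ℕ.≤-trans (k-least p) p≤)

    goodHierarchy : 1 ℕ.≤ n → Connected G →
      ¬ ¬ (∃[ H ] (ShortWalks H × fromℕ 3 * cost G (heightℝ H) + total ≤ fromℕ 2 * fromℕ n * total))
    goodHierarchy 1≤n conn = do
      t , t↭ , L , good ← goodTree n (allFin n) (ℕ.≤-reflexive |allFin|) (≡.subst (1 ℕ.≤_) (≡.sym |allFin|) 1≤n)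
        (allFin⁺ n) (λ {x} {y} _ _ → Star.map (λ e → ∈-allFin _ , ∈-allFin _ , e) (conn x y))
      let H = record { tree = t ; leaves↭ = t↭ }
      return (H , height-walk H L ,
        ≤-trans (≤-reflexive (+-congʳ (*-congˡ (cost-height H))))
          (≡.subst (λ m → fromℕ 3 * treeCost T t + total ≤ fromℕ 2 * fromℕ m * total) |allFin| good))
      where
      |allFin| : length (allFin n) ≡ n
      |allFin| = List.length-tabulate id

    -- Existence of the two minima.

    -- A matrix with entries at most `D` is coded by an element of a finite type, and the minimum is
    -- taken over all codes. Several `a` may share a matrix, so `HasCode` only asks for one with
    -- property `P`.
    minimum-cost : ∀ {a p} {A : Set a} (P : A → Set p) (v : A → Fin n → Fin n → ℕ) D →
                   (∀ {a} → P a → ∀ x y → v a x y ℕ.≤ D) → ∃[ a ] P a →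
                   ¬ ¬ (∃[ m ] IsMinimum P (λ a → cost G (λ x y → fromℕ (v a x y))) m)
    minimum-cost {A = A} P v D bounded (a₀ , Pa₀) = do
      inj₂ (i , _ , (a , Pa , a-code) , i-min) ← minimum (allFin _) HasCode (λ i → cost G (λ x y → fromℕ (decode i x y)))
        where inj₁ none → contradiction (a₀ , Pa₀ , decode-encode Pa₀) (none (∈-allFin (encode Pa₀)))
      return (_ , (a , Pa , cost-code a-code) , λ b Pb →
        ≤-trans (i-min (∈-allFin (encode Pb)) (b , Pb , decode-encode Pb))
                (≤-reflexive (sym (cost-code (decode-encode Pb)))))
      where
      Code = Fin ((suc D ℕ.^ n) ℕ.^ n)

      decode : Code → Fin n → Fin n → ℕ
      decode i x y = toℕ (finToFun {suc D} {n} (finToFun i x) y)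

      HasCode : Code → Set _
      HasCode i = ∃[ a ] (P a × (∀ x y → v a x y ≡ decode i x y))

      encode : ∀ {a} → P a → Code
      encode Pa = funToFin λ x → funToFin λ y → fromℕ< (ℕ.s≤s (bounded Pa x y))

      decode-encode : ∀ {a} (Pa : P a) x y → v a x y ≡ decode (encode Pa) x y
      decode-encode Pa x y = ≡.sym (≡.trans
        (≡.cong (λ k → toℕ (finToFun k y)) (Fin.finToFun-funToFin _ x))
        (≡.trans (≡.cong toℕ (Fin.finToFun-funToFin _ y)) (Fin.toℕ-fromℕ< _)))

      cost-code : ∀ {a i} → (∀ x y → v a x y ≡ decode i x y) →
                  cost G (λ x y → fromℕ (v a x y)) ≈ cost G (λ x y → fromℕ (decode i x y))
      cost-code eq = cost-cong λ x y → reflexive (≡.cong fromℕ (eq x y))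

    distance-exists : Connected G → ∀ x y → ¬ ¬ (∃[ k ] IsDistance G x y k)
    distance-exists conn x y = do
      k , is-length , k-least ← least (λ k → ∃[ p ] walkLength G {x} {y} p ≡ k) (conn x y , ≡.refl)
      return (k , is-length , λ p → k-least _ (p , ≡.refl))

    IsFeasibleℕ : (Fin n → Fin n → ℕ) → Set _
    IsFeasibleℕ v = IsUltrametricℕ v × DominatesDistance G (λ x y → fromℕ (v x y))

    -- Taking integer parts is monotone, which preserves symmetry and the maximum inequality.
    -- Distances are integers not exceeding `D`, so they stay below the truncated integer part.
    floor-feasible : ∀ {u D} → Connected G → IsUltrametric u → DominatesDistance G u →
                     (∀ x y k → IsDistance G x y k → k ℕ.≤ D) →
                     ∀ v → (∀ x y → IsFloor D (u x y) (v x y)) → IsFeasibleℕ v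
    floor-feasible {u} {D} conn U dom diam≤D v fl = record
      { ≡⇒0       = λ x → fromℕ≈0⇒≡0 _ (≤-antisym (≤-trans (v≤u x x) (≤-reflexive (≈⇒0 ≡.refl))) (fromℕ-nonNeg (v x x)))
      ; 0⇒≡       = 0⇒≡
      ; symmetric = λ x y → ℕ.≤-antisym (symm x y) (symm y x)
      ; ultra     = ultra
      } , λ x y k d → fromℕ-mono (dist≤v x y k d)
      where
      open IsUltrametric U
      open Metric.IsGeneralMetric isMetric using (≈⇒0) renaming (sym to u-sym)

      v≤u : ∀ x y → fromℕ (v x y) ≤ u x y
      v≤u x y = proj₁ (proj₂ (fl x y))

      greatest : ∀ x y j → j ℕ.≤ D → fromℕ j ≤ u x y → j ℕ.≤ v x y
      greatest x y = proj₂ (proj₂ (fl x y))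

      dist≤v : ∀ x y k → IsDistance G x y k → k ℕ.≤ v x y
      dist≤v x y k d = greatest x y k (diam≤D x y k d) (dom x y k d)

      0⇒≡ : ∀ {x y} → v x y ≡ 0 → x ≡ y
      -- By domination a vanishing integer part forces distance 0, hence an empty walk. The distance
      -- is known only up to double negation, which suffices for a decidable equality.
      0⇒≡ {x} {y} v≡0 = decidable-stable (x Fin.≟ y) do
        k , d@((p , |p|≡k) , _) ← distance-exists conn x y
        return (from-walk p (ℕ.n≤0⇒n≡0 (≡.subst₂ ℕ._≤_ (≡.sym |p|≡k) v≡0 (dist≤v x y k d))))
        where
        from-walk : (p : Star _~_ x y) → walkLength G p ≡ 0 → x ≡ y
        from-walk ε _ = ≡.refl

      symm : ∀ x y → v x y ℕ.≤ v y x
      symm x y = greatest y x (v x y) (proj₁ (fl x y)) (≤-trans (v≤u x y) (≤-reflexive (u-sym x y)))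

      ultra : ∀ x y z → v x z ℕ.≤ v x y ℕ.⊔ v y z
      ultra x y z = decidable-stable (v x z ℕ.≤? v x y ℕ.⊔ v y z) do
        inj₁ ≤xy ← ≤⊔⇒¬¬≤⊎≤ (≤-trans (v≤u x z) (ultratriangle x y z))
          where inj₂ ≤yz → return (ℕ.≤-trans (greatest y z _ (proj₁ (fl x z)) ≤yz) (ℕ.m≤n⊔m (v x y) (v y z)))
        return (ℕ.≤-trans (greatest x y _ (proj₁ (fl x z)) ≤xy) (ℕ.m≤m⊔n (v x y) (v y z)))

    OPT-card-exists : 1 ℕ.≤ n → Connected G → ¬ ¬ (∃[ b ] IsOPT-card G b)
    OPT-card-exists 1≤n conn = do
      H , walks , _ ← goodHierarchy 1≤n conn
      minimum-cost (DominatesDistance G ∘ heightℝ) height n (λ {H} _ → height≤n H)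
        (H , ShortWalks⇒dominates H walks)

    -- The minimum is taken over natural-valued feasible ultrametrics bounded by `n`. The heights of
    -- a good hierarchy show that one exists, and its short walks show that truncation at `n` cuts
    -- off no distance.
    OPT-free-exists : 1 ℕ.≤ n → Connected G → ¬ ¬ (∃[ a ] IsOPT-free G a)
    OPT-free-exists 1≤n conn = do
      H , walks , _ ← goodHierarchy 1≤n conn
      a , (v , ((V , v-dom) , _) , v-cost) , v-min ← minimum-cost
        (λ v → IsFeasibleℕ v × (∀ x y → v x y ℕ.≤ n)) id n proj₂
        (height H , (height-isUltrametricℕ H , ShortWalks⇒dominates H walks) , height≤n H)
      let diam≤n : ∀ x y k → IsDistance G x y k → k ℕ.≤ n
          diam≤n x y k = λ (_ , k-least) →
            ℕ.≤-trans (k-least (proj₁ (walks x y))) (ℕ.≤-trans (proj₂ (walks x y)) (height≤n H x y))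
      return (a , ((λ x y → fromℕ (v x y)) , (fromℕ-isUltrametric V , v-dom) , v-cost) ,
        -- The competitor `u` is replaced by its truncated integer part, which is feasible and costs
        -- no more.
        λ u (U , u-dom) → ≤-stable do
          fl ← ¬¬-∀Fin λ x → ¬¬-∀Fin λ y →
            floor-exists n (Metric.IsGeneralMetric.nonNegative (IsUltrametric.isMetric U) {x} {y})
          let ⌊u⌋ = λ x y → proj₁ (fl x y)
              isFloor = λ x y → proj₂ (fl x y)
          return (≤-trans
            (v-min ⌊u⌋ (floor-feasible conn U u-dom diam≤n ⌊u⌋ isFloor , λ x y → proj₁ (isFloor x y)))
            (cost-mono λ x y → proj₁ (proj₂ (isFloor x y)))))

    -- The two bounds on the ratio.

    ratio-bounds : 2 ℕ.≤ n → Connected G → ∀ a b → IsOPT-free G a → IsOPT-card G b →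
                   Σ[ 0<a ∈ 0# < a ] (1# ≤ b / a [ 0<a ] × b / a [ 0<a ] ≤ ⟨2 n -1⟩/3)
    ratio-bounds 2≤n conn a b ((u , (_ , u-dom) , u-cost) , a-min) ((H , H-dom , H-cost) , b-min) =
      -- The upper bound is cross-multiplied first: it becomes an inequality, and by stability the
      -- hierarchy may be given up to double negation.
      0<a , x≤y⇒1≤y/x 0<a a≤b , /-cross-≤ 0<a (0<fromℕ[1+n] 2) (≤-stable do
        H′ , walks , good ← goodHierarchy 1≤n conn
        return (begin
          fromℕ 3 * b                        ≤⟨ *-monoʳ-≤ (fromℕ-nonNeg 3) (b-min H′ (ShortWalks⇒dominates H′ walks)) ⟩
          fromℕ 3 * cost G (heightℝ H′)      ≤⟨ x+w≤yw⇒x≤[y-1]w good ⟩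
          (fromℕ 2 * fromℕ n - 1#) * total   ≤⟨ *-monoʳ-≤ 0≤2n-1 total≤a ⟩
          (fromℕ 2 * fromℕ n - 1#) * a       ∎))
      where
      open ≤-Reasoning
      1≤n = ℕ.≤-trans (ℕ.n≤1+n 1) 2≤n

      total≤a : total ≤ a
      total≤a = ≤-trans (total≤cost u-dom) (≤-reflexive u-cost)

      0<a : 0# < a
      0<a = <-≤-trans (total-pos 2≤n conn) total≤a

      a≤b : a ≤ b
      a≤b = ≤-trans (a-min (heightℝ H) (fromℕ-isUltrametric (height-isUltrametricℕ H) , H-dom)) (≤-reflexive H-cost)

      0≤2n-1 : 0# ≤ fromℕ 2 * fromℕ n - 1#
      0≤2n-1 = begin
        0#                              ≈⟨ -‿inverseʳ 1# ⟨
        1# - 1#                         ≈⟨ +-congʳ (+-identityʳ 1#) ⟨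
        fromℕ 1 - 1#                    ≤⟨ +-mono-≤ (fromℕ-mono (ℕ.≤-trans 1≤n (ℕ.m≤n*m n 2))) ≤-refl ⟩
        fromℕ (2 ℕ.* n) - 1#            ≈⟨ +-congʳ (fromℕ-* 2 n) ⟩
        fromℕ 2 * fromℕ n - 1#          ∎

  -- Equality for the complete graph.

  module _ {n : ℕ} where

    private
      Tᴷ : Fin n → Fin n → Carrier
      Tᴷ = T (K n)

      Tᴷ-≡ : ∀ {x y} → x ≡ y → Tᴷ x y ≈ 0#
      Tᴷ-≡ x≡y = T-≁ (K n) λ x≢y → x≢y x≡y

      Tᴷ-> : ∀ {x y} → ¬ (x Fin.< y) → Tᴷ x y ≈ 0#
      Tᴷ-> {x} {y} x≮y with x Fin.<? y | x Fin.≟ y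
      ... | yes x<y | _     = contradiction x<y x≮y
      ... | no  _   | yes _ = refl
      ... | no  _   | no  _ = refl

      Tᴷ-< : ∀ {x y} → x Fin.< y → Tᴷ x y ≈ 1#
      Tᴷ-< {x} {y} x<y with x Fin.<? y | x Fin.≟ y
      ... | no  x≮y | _          = contradiction x<y x≮y
      ... | yes _   | yes ≡.refl = contradiction x<y (Fin.<-irrefl ≡.refl)
      ... | yes _   | no  _      = refl

    Tᴷ-total : ∀ {x y} → x ≢ y → Tᴷ x y + Tᴷ y x ≈ 1#
    Tᴷ-total {x} {y} x≢y with Fin.<-cmp x y
    ... | tri< x<y _ y≮x = trans (+-cong (Tᴷ-< x<y) (Tᴷ-> y≮x)) (+-identityʳ 1#)
    ... | tri≈ _ x≡y _   = contradiction x≡y x≢y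
    ... | tri> x≮y _ y<x = trans (+-cong (Tᴷ-> x≮y) (Tᴷ-< y<x)) (+-identityˡ 1#)

    cross-K : ∀ {xs ys} → Disjoint xs ys → cross Tᴷ xs ys ≈ fromℕ (length xs) * fromℕ (length ys)
    cross-K {xs} {ys} disj = begin
      ∑∑ xs ys Tᴷ + ∑∑ ys xs Tᴷ
        ≈⟨ +-congˡ (∑-swap ys xs) ⟩
      ∑∑ xs ys Tᴷ + ∑∑ xs ys (λ x y → Tᴷ y x)
        ≈⟨ trans (∑-cong xs λ _ → ∑-+ ys) (∑-+ xs) ⟨
      ∑∑ xs ys (λ x y → Tᴷ x y + Tᴷ y x)
        ≈⟨ ∑∑-cong xs ys (λ {x} {y} x∈ y∈ → Tᴷ-total {x} {y} λ where ≡.refl → disj (x∈ , y∈)) ⟩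
      ∑∑ xs ys (λ _ _ → 1#)
        ≈⟨ ∑-cong xs (λ _ → trans (∑-const 1# ys) (*-identityʳ _)) ⟩
      ∑[ _ ∈ xs ] fromℕ (length ys)
        ≈⟨ ∑-const _ xs ⟩
      fromℕ (length xs) * fromℕ (length ys) ∎
      where open import Relation.Binary.Reasoning.Setoid setoid

    private
      -- With `a = i + 1` and `b = j + 1` this is `C(a + b, 2) = C(a, 2) + C(b, 2) + a b`.
      -- Successors avoid subtraction in `a (a - 1)`.
      weight-merge : ∀ i j {w₁ w₂ c} →
                     fromℕ 2 * w₁ ≈ fromℕ (suc i) * fromℕ i → fromℕ 2 * w₂ ≈ fromℕ (suc j) * fromℕ j →
                     c ≈ fromℕ (suc i) * fromℕ (suc j) →
                     fromℕ 2 * (w₁ + w₂ + c) ≈ fromℕ (suc i ℕ.+ suc j) * fromℕ (i ℕ.+ suc j)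
      weight-merge i j {w₁} {w₂} {c} W₁ W₂ C = begin
        fromℕ 2 * (w₁ + w₂ + c)
          ≈⟨ trans (distribˡ _ _ _) (+-cong (trans (distribˡ _ _ _) (+-cong W₁ W₂)) (*-congˡ C)) ⟩
        (1# + I) * I + (1# + J) * J + fromℕ 2 * ((1# + I) * (1# + J))
          ≈⟨ solve 2 (λ i j →
               (#1 :+ i) :* i :+ (#1 :+ j) :* j :+ #2 :* ((#1 :+ i) :* (#1 :+ j)) :=
               (#1 :+ (i :+ (#1 :+ j))) :* (i :+ (#1 :+ j))) refl I J ⟩
        (1# + (I + (1# + J))) * (I + (1# + J))
          ≈⟨ *-cong (+-congˡ (fromℕ-+ i (suc j))) (fromℕ-+ i (suc j)) ⟨
        fromℕ (suc i ℕ.+ suc j) * fromℕ (i ℕ.+ suc j) ∎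
        where
        open import Relation.Binary.Reasoning.Setoid setoid
        I = fromℕ i
        J = fromℕ j

      cost-merge : ∀ i j {c₁ c₂ w₁ w₂ c} →
                   fromℕ 3 * c₁ + w₁ ≈ fromℕ 2 * fromℕ (suc i) * w₁ →
                   fromℕ 3 * c₂ + w₂ ≈ fromℕ 2 * fromℕ (suc j) * w₂ →
                   fromℕ 2 * w₁ ≈ fromℕ (suc i) * fromℕ i → fromℕ 2 * w₂ ≈ fromℕ (suc j) * fromℕ j →
                   c ≈ fromℕ (suc i) * fromℕ (suc j) →
                   fromℕ 3 * (c₁ + c₂ + fromℕ (i ℕ.+ suc j) * c) + (w₁ + w₂ + c) ≈
                   fromℕ 2 * fromℕ (suc i ℕ.+ suc j) * (w₁ + w₂ + c)
      cost-merge i j {c₁} {c₂} {w₁} {w₂} {c} C₁ C₂ W₁ W₂ C = begin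
        fromℕ 3 * (c₁ + c₂ + P * c) + (w₁ + w₂ + c)
          ≈⟨ solve 6 (λ p c₁ c₂ w₁ w₂ c →
               #3 :* (c₁ :+ c₂ :+ p :* c) :+ (w₁ :+ w₂ :+ c) :=
               (#3 :* c₁ :+ w₁) :+ (#3 :* c₂ :+ w₂) :+ (#3 :* p :+ #1) :* c) refl P c₁ c₂ w₁ w₂ c ⟩
        (fromℕ 3 * c₁ + w₁) + (fromℕ 3 * c₂ + w₂) + (fromℕ 3 * P + 1#) * c
          ≈⟨ +-congʳ (+-cong C₁ C₂) ⟩
        fromℕ 2 * (1# + I) * w₁ + fromℕ 2 * (1# + J) * w₂ + (fromℕ 3 * P + 1#) * c
          ≈⟨ +-cong (+-cong (regroup _ _) (regroup _ _)) (*-congʳ (+-congʳ (*-congˡ (fromℕ-+ i (suc j))))) ⟩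
        (1# + I) * (fromℕ 2 * w₁) + (1# + J) * (fromℕ 2 * w₂) + (fromℕ 3 * (I + (1# + J)) + 1#) * c
          ≈⟨ +-cong (+-cong (*-congˡ W₁) (*-congˡ W₂)) (*-congˡ C) ⟩
        (1# + I) * ((1# + I) * I) + (1# + J) * ((1# + J) * J) +
        (fromℕ 3 * (I + (1# + J)) + 1#) * ((1# + I) * (1# + J))
          -- With `a = i + 1` and `b = j + 1`, both sides equal `(a + b)^3 - (a + b)^2`.
          ≈⟨ solve 2 (λ i j →
               (#1 :+ i) :* ((#1 :+ i) :* i) :+ (#1 :+ j) :* ((#1 :+ j) :* j) :+
               (#3 :* (i :+ (#1 :+ j)) :+ #1) :* ((#1 :+ i) :* (#1 :+ j)) :=
               (#1 :+ (i :+ (#1 :+ j))) :*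
               ((#1 :+ i) :* i :+ (#1 :+ j) :* j :+ #2 :* ((#1 :+ i) :* (#1 :+ j)))) refl I J ⟩
        (1# + (I + (1# + J))) * ((1# + I) * I + (1# + J) * J + fromℕ 2 * ((1# + I) * (1# + J)))
          ≈⟨ *-cong (+-congˡ (fromℕ-+ i (suc j))) (+-cong (+-cong W₁ W₂) (*-congˡ C)) ⟨
        fromℕ (suc i ℕ.+ suc j) * (fromℕ 2 * w₁ + fromℕ 2 * w₂ + fromℕ 2 * c)
          ≈⟨ *-congˡ (trans (distribˡ _ _ _) (+-congʳ (distribˡ _ _ _))) ⟨
        fromℕ (suc i ℕ.+ suc j) * (fromℕ 2 * (w₁ + w₂ + c))
          ≈⟨ regroup _ _ ⟨
        fromℕ 2 * fromℕ (suc i ℕ.+ suc j) * (w₁ + w₂ + c) ∎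
        where
        open import Relation.Binary.Reasoning.Setoid setoid
        I = fromℕ i
        J = fromℕ j
        P = fromℕ (i ℕ.+ suc j)
        regroup : ∀ m w → fromℕ 2 * m * w ≈ m * (fromℕ 2 * w)
        regroup = solve 2 (λ m w → #2 :* m :* w := m :* (#2 :* w)) refl

    treeWeight-K : ∀ t → Unique (leaves t) →
                   fromℕ 2 * ∑∑ (leaves t) (leaves t) Tᴷ ≈ fromℕ ∣ t ∣ * fromℕ (∣ t ∣ ∸ 1)
    treeWeight-K (leaf x) _ =
      trans (*-congˡ (trans (+-identityʳ _) (trans (+-identityʳ _) (Tᴷ-≡ {x} ≡.refl))))
            (trans (zeroʳ _) (sym (zeroʳ _)))
    treeWeight-K (node l m r) u with ul , ur , disj ← Unique-node⁻ l {m} r u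
      rewrite leaves-node l {m} r | List.length-++ (leaves l) {leaves r}
      -- Trees have at least one leaf, so abstracting the sizes leaves only successors to match.
      with ∣ l ∣ | ∣t∣≥1 l | treeWeight-K l ul | ∣ r ∣ | ∣t∣≥1 r | treeWeight-K r ur
         | cross-K {leaves l} {leaves r} disj
    ... | suc i | _ | W₁ | suc j | _ | W₂ | C =
      trans (*-congˡ (∑∑-++ (leaves l) (leaves r))) (weight-merge i j W₁ W₂ C)

    -- Equality in the bound of `IsGoodTree`, whatever the shape of the tree: in `cost-merge` the
    -- result depends only on the sum of the two sizes.
    treeCost-K : ∀ t → Unique (leaves t) →
                 fromℕ 3 * treeCost Tᴷ t + ∑∑ (leaves t) (leaves t) Tᴷ ≈
                 fromℕ 2 * fromℕ ∣ t ∣ * ∑∑ (leaves t) (leaves t) Tᴷ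
    treeCost-K (leaf x) _ =
      trans (+-cong (zeroʳ _) W≈0) (trans (+-identityʳ 0#) (sym (trans (*-congˡ W≈0) (zeroʳ _))))
      where
      W≈0 : ∑∑ [ x ] [ x ] Tᴷ ≈ 0#
      W≈0 = trans (+-identityʳ _) (trans (+-identityʳ _) (Tᴷ-≡ {x} ≡.refl))
    treeCost-K (node l m r) u with ul , ur , disj ← Unique-node⁻ l {m} r u
      rewrite leaves-node l {m} r | List.length-++ (leaves l) {leaves r}
      with ∣ l ∣ | ∣t∣≥1 l | treeWeight-K l ul | treeCost-K l ul
         | ∣ r ∣ | ∣t∣≥1 r | treeWeight-K r ur | treeCost-K r ur | cross-K {leaves l} {leaves r} disj
    ... | suc i | _ | W₁ | C₁ | suc j | _ | W₂ | C₂ | C =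
      trans (+-congˡ (∑∑-++ (leaves l) (leaves r)))
        (trans (cost-merge i j C₁ C₂ W₁ W₂ C) (*-congˡ (sym (∑∑-++ (leaves l) (leaves r)))))

    hierarchyCost-K : ∀ H → fromℕ 3 * cost (K n) (heightℝ H) ≈ (fromℕ 2 * fromℕ n - 1#) * total (K n)
    hierarchyCost-K H = x+w≈yw⇒x≈[y-1]w (begin
      fromℕ 3 * cost (K n) (heightℝ H) + total (K n)
        ≈⟨ +-cong (*-congˡ (cost-height (K n) H)) total≈ ⟩
      fromℕ 3 * treeCost Tᴷ tree + ∑∑ (leaves tree) (leaves tree) Tᴷ
        ≈⟨ treeCost-K tree (leaves-unique H) ⟩
      fromℕ 2 * fromℕ ∣ tree ∣ * ∑∑ (leaves tree) (leaves tree) Tᴷ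
        ≈⟨ *-cong (*-congˡ (reflexive (≡.cong fromℕ (∣tree∣≡n H)))) (sym total≈) ⟩
      fromℕ 2 * fromℕ n * total (K n) ∎)
      where
      open import Relation.Binary.Reasoning.Setoid setoid
      open Hierarchy H
      total≈ : total (K n) ≈ ∑∑ (leaves tree) (leaves tree) Tᴷ
      total≈ = ∑∑-↭ (↭.↭-sym leaves↭) (↭.↭-sym leaves↭)

    -- The shortest-path metric of `K n`. Being an ultrametric itself, it attains the lower bound
    -- `total`.
    discrete : Fin n → Fin n → ℕ
    discrete x y = if does (x Fin.≟ y) then 0 else 1

    discrete-refl : ∀ x → discrete x x ≡ 0
    discrete-refl x rewrite dec-true (x Fin.≟ x) ≡.refl = ≡.refl

    discrete-≢ : ∀ {x y} → x ≢ y → discrete x y ≡ 1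
    discrete-≢ {x} {y} x≢y rewrite dec-false (x Fin.≟ y) x≢y = ≡.refl

    discrete-isUltrametricℕ : IsUltrametricℕ discrete
    discrete-isUltrametricℕ = record
      { ≡⇒0 = discrete-refl ; 0⇒≡ = 0⇒≡ ; symmetric = symm ; ultra = ultra }
      where
      0⇒≡ : ∀ {x y} → discrete x y ≡ 0 → x ≡ y
      0⇒≡ {x} {y} eq with x Fin.≟ y
      ... | yes x≡y = x≡y

      symm : ∀ x y → discrete x y ≡ discrete y x
      symm x y with x Fin.≟ y
      ... | yes ≡.refl = ≡.sym (discrete-refl x)
      ... | no  x≢y    = ≡.sym (discrete-≢ (x≢y ∘ ≡.sym))

      ultra : ∀ x y z → discrete x z ℕ.≤ discrete x y ℕ.⊔ discrete y z
      ultra x y z with x Fin.≟ y | y Fin.≟ z | x Fin.≟ z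
      ... | _          | _          | yes _  = ℕ.z≤n
      ... | no _       | yes _      | no _   = ℕ.≤-refl
      ... | no _       | no _       | no _   = ℕ.≤-refl
      ... | yes _      | no _       | no _   = ℕ.≤-refl
      ... | yes ≡.refl | yes ≡.refl | no x≢x = contradiction ≡.refl x≢x

    dominates-K : ∀ {v : Fin n → Fin n → ℕ} → (∀ {x y} → x ≢ y → 1 ℕ.≤ v x y) →
                  DominatesDistance (K n) (λ x y → fromℕ (v x y))
    dominates-K {v} 1≤v x y k (_ , k-least) with x Fin.≟ y
    ... | yes ≡.refl = fromℕ-mono {n = v x x} (ℕ.≤-trans (k-least ε) ℕ.z≤n)
    ... | no  x≢y    = fromℕ-mono (ℕ.≤-trans (k-least (x≢y ◅ ε)) (1≤v x≢y))

    discreteCost-K : cost (K n) (λ x y → fromℕ (discrete x y)) ≈ total (K n)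
    discreteCost-K = trans (cost≈∑∑ (K n) _) (∑∑-cong (allFin n) (allFin n) λ {x} {y} _ _ → T*disc x y)
      where
      T*disc : ∀ x y → Tᴷ x y * fromℕ (discrete x y) ≈ Tᴷ x y
      T*disc x y = by-cases (x Fin.≟ y)
        where
        by-cases : Dec (x ≡ y) → Tᴷ x y * fromℕ (discrete x y) ≈ Tᴷ x y
        by-cases (yes x≡y) = trans (*-congʳ (Tᴷ-≡ x≡y)) (trans (zeroˡ _) (sym (Tᴷ-≡ x≡y)))
        by-cases (no  x≢y) rewrite discrete-≢ x≢y = trans (*-congˡ (+-identityʳ 1#)) (*-identityʳ _)

    IsOPT-free-K : IsOPT-free (K n) (total (K n))
    IsOPT-free-K =
      ((λ x y → fromℕ (discrete x y)) ,
        (fromℕ-isUltrametric discrete-isUltrametricℕ ,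
          dominates-K λ x≢y → ℕ.≤-reflexive (≡.sym (discrete-≢ x≢y))) ,
        discreteCost-K) ,
      λ u (_ , u-dom) → total≤cost (K n) u-dom

    -- Every hierarchy is feasible here, and three times its cost is one fixed quantity, so all of
    -- them are minimal.
    IsOPT-card-K : ∀ H → IsOPT-card (K n) (cost (K n) (heightℝ H))
    IsOPT-card-K H = (H , dominates-K (height≥1 H) , refl) , λ H′ _ → ≤-reflexive
      (*-cancelˡ (0<fromℕ[1+n] 2) (trans (hierarchyCost-K H) (sym (hierarchyCost-K H′))))

  -- Both minimisers are explicit, so no double negation enters.
  ratio-K : ∀ n → 2 ℕ.≤ n → ∃[ a ] ∃[ b ] (IsOPT-free (K n) a × IsOPT-card (K n) b ×
              Σ[ 0<a ∈ 0# < a ] (b / a [ 0<a ] ≈ ⟨2 n -1⟩/3))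
  ratio-K n@(suc (suc _)) 2≤n@(ℕ.s≤s (ℕ.s≤s _)) =
    total (K n) , cost (K n) (heightℝ H) , IsOPT-free-K , IsOPT-card-K H ,
    0<total , /-cross-≈ 0<total (0<fromℕ[1+n] 2) (hierarchyCost-K H)
    where
    H : Hierarchy n
    H = record
      { tree    = fromList zero (tabulate suc)
      ; leaves↭ = ↭.↭-reflexive (leaves-fromList zero (tabulate suc))
      }

    K-connected : Connected (K n)
    K-connected x y with x Fin.≟ y
    ... | yes ≡.refl = ε
    ... | no  x≢y    = x≢y ◅ ε

    0<total : 0# < total (K n)
    0<total = total-pos (K n) 2≤n K-connected

theorem7 : ∀ {c ℓ₁ ℓ₂} (R : Reals c ℓ₁ ℓ₂) →
  let open Reals R
      open Optimisation R
  in
  (∀ n → 2 ≤ℕ n → (G : WeightedGraph n) → Connected G →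
    ¬ ¬ (∃[ a ] IsOPT-free G a) ×
    ¬ ¬ (∃[ b ] IsOPT-card G b) ×
    (∀ a b → IsOPT-free G a → IsOPT-card G b →
      Σ[ 0<a ∈ 0# < a ]
        (1# ≤ b / a [ 0<a ] × b / a [ 0<a ] ≤ ⟨2 n -1⟩/3)))
  ×
  (∀ n → 2 ≤ℕ n →
    ∃[ a ] ∃[ b ] (IsOPT-free (K n) a × IsOPT-card (K n) b ×
      Σ[ 0<a ∈ 0# < a ] (b / a [ 0<a ] ≈ ⟨2 n -1⟩/3)))
theorem7 R =
  (λ n 2≤n G conn →
    let 1≤n = ℕ.≤-trans (ℕ.n≤1+n 1) 2≤n in
    OPT-free-exists G 1≤n conn , OPT-card-exists G 1≤n conn , ratio-bounds G 2≤n conn) ,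
  ratio-K
  where open Main R
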